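{- Let $\Phi$ be a (possibly reducible) finite crystallographic root system with irreducible components $\Phi_1,\dots,\Phi_k$. Let $\mathbb E_i=\mathrm{Span}(\Phi_i)$, let $\mathcal P_i$ be the root polytope of $\Phi_i$, and for a face $F$ of $\mathcal P_\Phi$ set $F_i=F\cap \mathbb E_i$. (1) The map $F\mapsto (F_1,\dots,F_k)$ is a bijection between the proper faces of $\mathcal P_\Phi$ and the $k$-tuples $(\overline F_1,\dots,\overline F_k)$ where $\overline F_i$ is a proper face of $\mathcal P_i$ for every $i\in\{1,\dots,k\}$. (2) A proper face $F$ of $\mathcal P_\Phi$ has dimension $\dim F=k-1+\sum_{i=1}^k\dim F_i$. (3) A face $F$ of $\mathcal P_\Phi$ is standard if and only if $F_i$ is a standard face of $\mathcal P_i$ for all $i\in\{1,\dots,k\}$.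
   Context: $\Phi$ is a finite reduced crystallographic root system in the real vector space $\mathbb E=\mathrm{Span}_{\mathbb R}\Phi$ with (Weyl-group-invariant) positive definite bilinear form $(\cdot,\cdot)$; $\Pi$ is a set of simple roots and $\Pi_i=\Pi\cap\Phi_i$. $\mathcal C=\{x\in\mathbb E:(x,\alpha)\ge 0\ \forall \alpha\in\Pi\}$ is the (closed) fundamental chamber, and $\mathcal C_i=\mathcal C\cap\mathbb E_i$ is that of $\Phi_i$ with respect to $\Pi_i$. The root polytope of a root system is the convex hull of all its roots; $\mathcal P_i=\mathcal P_\Phi\cap\mathbb E_i$. A proper face is a possibly empty face different from the whole polytope. The empty face has dimension $-1$. A face $F$ of $\mathcal P_\Phi$ (resp. $\mathcal P_i$) is standard if either its relative interior (interior within its affine hull) meets $\mathcal C$ (resp. $\mathcal C_i$), or $F=\emptyset$. -}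

module Defs where

open import Level using (0ℓ)
open import Algebra.Bundles using (CommutativeRing)
open import Algebra.Module.Bundles using (Module)
open import Data.Nat.Base as ℕ using (ℕ)
open import Data.Integer.Base as ℤ using (ℤ; +_; -[1+_]; 0ℤ; 1ℤ)
open import Data.Integer.Properties using (+-0-commutativeMonoid)
open import Data.Fin.Base using (Fin)
open import Data.Product.Base using (Σ; ∃; _×_; _,_; proj₁; proj₂)
open import Data.Sum.Base using (_⊎_)
open import Function.Base using (_on_)
open import Relation.Binary.Core using (Rel)
open import Relation.Binary.Structures using (IsDecTotalOrder)
open import Relation.Binary.PropositionalEquality.Core using (_≡_; _≢_)
open import Relation.Nullary.Negation.Core using (¬_)
open import Relation.Unary
  using (Pred; _∈_; _⊆_; _≐_; _∩_; _∪_; Empty; Satisfiable; ⋃)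
import Algebra.Definitions.RawMonoid as RawMonoidDefs
import Algebra.Properties.CommutativeMonoid.Sum as Sums

-- The real numbers, given axiomatically as a Dedekind-complete ordered field
-- (unique up to isomorphism).  As in classical mathematics the order is
-- decidable.  The value of  _⁻¹  at zero is unspecified and never matters.
record Reals : Set₁ where
  field
    commutativeRing : CommutativeRing 0ℓ 0ℓ
  open CommutativeRing commutativeRing public
  infix 4 _≤_ _<_
  infix 8 _⁻¹
  field
    _≤_             : Rel Carrier 0ℓ
    isDecTotalOrder : IsDecTotalOrder _≈_ _≤_
    +-monoˡ-≤       : ∀ z {x y} → x ≤ y → x + z ≤ y + z
    *-nonNegative   : ∀ {x y} → 0# ≤ x → 0# ≤ y → 0# ≤ x * y
    0≉1             : ¬ (0# ≈ 1#)
    _⁻¹             : Carrier → Carrier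
    ⁻¹-inverseʳ     : ∀ {x} → ¬ (x ≈ 0#) → x * x ⁻¹ ≈ 1#

  _<_ : Rel Carrier 0ℓ
  x < y = x ≤ y × ¬ (x ≈ y)

  IsUpperBound : Pred Carrier 0ℓ → Pred Carrier 0ℓ
  IsUpperBound S u = ∀ {x} → x ∈ S → x ≤ u

  field
    supremum : (S : Pred Carrier 0ℓ) → Satisfiable S → Satisfiable (IsUpperBound S) →
               ∃ λ s → IsUpperBound S s × (∀ {u} → IsUpperBound S u → s ≤ u)

  sum : ∀ {n} → (Fin n → Carrier) → Carrier
  sum = Sums.sum +-commutativeMonoid

  fromℕ : ℕ → Carrier
  fromℕ n = RawMonoidDefs._×_ +-rawMonoid n 1#

  fromℤ : ℤ → Carrier
  fromℤ (+ n)    = fromℕ n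
  fromℤ -[1+ n ] = - fromℕ (ℕ.suc n)

-- Finite-dimensionality is not a field: it follows from the existence of a
-- finite root system spanning the space.
record EuclideanSpace (ℝ : Reals) : Set₁ where
  open Reals ℝ
  field
    vectorSpace : Module commutativeRing 0ℓ 0ℓ
  open Module vectorSpace public
  field
    ⟨_,_⟩             : Carrierᴹ → Carrierᴹ → Carrier
    ⟨⟩-cong           : ∀ {x x′ y y′} → x ≈ᴹ x′ → y ≈ᴹ y′ → ⟨ x , y ⟩ ≈ ⟨ x′ , y′ ⟩
    ⟨⟩-additiveˡ      : ∀ x y z → ⟨ x +ᴹ y , z ⟩ ≈ ⟨ x , z ⟩ + ⟨ y , z ⟩
    ⟨⟩-homogeneousˡ   : ∀ c x y → ⟨ c *ₗ x , y ⟩ ≈ c * ⟨ x , y ⟩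
    ⟨⟩-symmetric      : ∀ x y → ⟨ x , y ⟩ ≈ ⟨ y , x ⟩
    positiveDefinite  : ∀ x → ¬ (x ≈ᴹ 0ᴹ) → 0# < ⟨ x , x ⟩

module Geometry {ℝ : Reals} (E : EuclideanSpace ℝ) where
  open Reals ℝ
  open EuclideanSpace E

  Subset : Set₁
  Subset = Pred Carrierᴹ 0ℓ

  infixl 6 _-ᴹ_
  _-ᴹ_ : Carrierᴹ → Carrierᴹ → Carrierᴹ
  x -ᴹ y = x +ᴹ (-ᴹ y)

  Range : ∀ {n} → (Fin n → Carrierᴹ) → Subset
  Range p x = ∃ λ j → p j ≈ᴹ x

  Orthogonal : Subset → Subset → Set
  Orthogonal A B = ∀ {x y} → x ∈ A → y ∈ B → ⟨ x , y ⟩ ≈ 0#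

  combination : ∀ {n} → (Fin n → Carrier) → (Fin n → Carrierᴹ) → Carrierᴹ
  combination c p = Sums.sum +ᴹ-commutativeMonoid λ j → c j *ₗ p j

  span : Subset → Subset
  span S x = ∃ λ n → Σ (Fin n → Carrier) λ c → Σ (Fin n → Carrierᴹ) λ p →
    (∀ j → p j ∈ S) × x ≈ᴹ combination c p

  affineHull : Subset → Subset
  affineHull S x = ∃ λ n → Σ (Fin n → Carrier) λ c → Σ (Fin n → Carrierᴹ) λ p →
    (∀ j → p j ∈ S) × sum c ≈ 1# × x ≈ᴹ combination c p

  convexHull : Subset → Subset
  convexHull S x = ∃ λ n → Σ (Fin n → Carrier) λ c → Σ (Fin n → Carrierᴹ) λ p →
    (∀ j → p j ∈ S) × (∀ j → 0# ≤ c j) × sum c ≈ 1# × x ≈ᴹ combination c p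

  LinearlyIndependent : ∀ {n} → (Fin n → Carrierᴹ) → Set
  LinearlyIndependent p =
    ∀ c → combination c p ≈ᴹ 0ᴹ → ∀ j → c j ≈ 0#

  AffinelyIndependent : ∀ {n} → (Fin n → Carrierᴹ) → Set
  AffinelyIndependent p =
    ∀ c → sum c ≈ 0# → combination c p ≈ᴹ 0ᴹ → ∀ j → c j ≈ 0#

  -- The affine hull of S has an affine basis with d + 1 points; the empty
  -- family is an affine basis of the empty set, which gives dimension -1.
  HasDimension : Subset → ℤ → Set
  HasDimension S d = ∃ λ n → Σ (Fin n → Carrierᴹ) λ p →
    AffinelyIndependent p × affineHull (Range p) ≐ affineHull S × d ≡ + n ℤ.- 1ℤ

  relativeInterior : Subset → Subset
  relativeInterior S x = x ∈ S × ∃ λ ε → 0# < ε ×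
    (∀ y → y ∈ affineHull S → ⟨ y -ᴹ x , y -ᴹ x ⟩ < ε * ε → y ∈ S)

  -- Faces are cut out by valid linear inequalities; every linear functional has
  -- the form ⟨ v , _ ⟩.  Taking v = 0 exhibits both P itself and the empty set
  -- as faces.
  IsFace : Subset → Subset → Set
  IsFace P F = ∃ λ v → ∃ λ c →
    (∀ {x} → x ∈ P → ⟨ v , x ⟩ ≤ c) × F ≐ (P ∩ λ x → ⟨ v , x ⟩ ≈ c)

  IsProperFace : Subset → Subset → Set
  IsProperFace P F = IsFace P F × ¬ (F ≐ P)

  ProperFace : Subset → Set₁
  ProperFace P = Σ Subset (IsProperFace P)

  infix 4 _≈ᶠ_
  _≈ᶠ_ : ∀ {P} → Rel (ProperFace P) 0ℓ
  _≈ᶠ_ = _≐_ on proj₁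

  -- Standardness of a face, relative to a chamber C.
  IsStandard : Subset → Subset → Set
  IsStandard C F = Satisfiable (relativeInterior F ∩ C) ⊎ Empty F

  IsStandardFace : Subset → Subset → Subset → Set
  IsStandardFace C P F = IsFace P F × IsStandard C F

  reflect : Carrierᴹ → Carrierᴹ → Carrierᴹ
  reflect α x = x -ᴹ (fromℕ 2 * ⟨ x , α ⟩ * ⟨ α , α ⟩ ⁻¹) *ₗ α

  -- Finite reduced crystallographic root systems.  The reflections are those of
  -- the bilinear form, so the form is automatically Weyl-group-invariant.  The
  -- enumeration of the roots may have repetitions.
  record RootSystem : Set where
    field
      size : ℕ
      root : Fin size → Carrierᴹ

    roots : Subset
    roots = Range root

    field
      spanning         : ∀ x → x ∈ span roots
      nonzero          : ∀ {α} → α ∈ roots → ¬ (α ≈ᴹ 0ᴹ)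
      reflectionClosed : ∀ {α β} → α ∈ roots → β ∈ roots → reflect α β ∈ roots
      crystallographic : ∀ {α β} → α ∈ roots → β ∈ roots →
                         ∃ λ z → fromℕ 2 * ⟨ β , α ⟩ * ⟨ α , α ⟩ ⁻¹ ≈ fromℤ z
      reduced          : ∀ {α} c → α ∈ roots → c *ₗ α ∈ roots → c ≈ 1# ⊎ c ≈ - 1#

  -- Simple roots span because the roots do, so they form a basis of the space.
  record SimpleRoots (Φ : RootSystem) : Set where
    open RootSystem Φ
    field
      rank        : ℕ
      simple      : Fin rank → Carrierᴹ
      simple∈Φ    : ∀ j → simple j ∈ roots
      independent : LinearlyIndependent simple
      decompose   : ∀ {α} → α ∈ roots → Σ (Fin rank → ℤ) λ z →
                    ((∀ j → 0ℤ ℤ.≤ z j) ⊎ (∀ j → z j ℤ.≤ 0ℤ)) ×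
                    α ≈ᴹ combination (λ j → fromℤ (z j)) simple

    chamber : Subset
    chamber x = ∀ j → 0# ≤ ⟨ x , simple j ⟩

  -- Two orthogonal sets of roots are
  -- automatically disjoint, since the form is definite and roots are nonzero.
  Irreducible : Subset → Set₁
  Irreducible Ψ = Satisfiable Ψ ×
    (∀ (A B : Subset) → Satisfiable A → Satisfiable B → Orthogonal A B →
     ¬ (Ψ ≐ (A ∪ B)))

  IrreducibleComponents : RootSystem → ∀ {k} → (Fin k → Subset) → Set₁
  IrreducibleComponents Φ {k} Φᵢ =
    RootSystem.roots Φ ≐ ⋃ (Fin k) Φᵢ ×
    (∀ {i j} → i ≢ j → Orthogonal (Φᵢ i) (Φᵢ j)) ×
    (∀ i → Irreducible (Φᵢ i))

sumℤ : ∀ {n} → (Fin n → ℤ) → ℤ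
sumℤ = Sums.sum +-0-commutativeMonoid

{-# OPTIONS --safe #-}

-- A convex combination of roots splits into its parts in the orthogonal spaces
-- 𝔼ᵢ, and Φᵢ = -Φᵢ puts the origin into every 𝒫ᵢ, so 𝒫 ∩ 𝔼ᵢ = 𝒫ᵢ.  A proper face
-- is the convex hull of the roots on some hyperplane ⟨ v , x ⟩ = c, where c > 0 by
-- symmetry.  After scaling to c = 1, v is the sum of its projections to the 𝔼ᵢ,
-- which can be prescribed independently: this is the bijection.  Because the
-- hyperplane misses the origin, dim F + 1 is the linear rank of the roots in F,
-- which is additive over orthogonal components.  Finally, the relative interior
-- of a face consists of the combinations with positive weights on all roots of
-- the face; such weights restrict to the components and glue from them, and
-- membership in the chamber is tested componentwise since every simple root
-- lies in one component.

module Submission where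

open import Level using (0ℓ)
open import Algebra.Bundles using (CommutativeRing)
open import Data.Nat.Base as ℕ using (ℕ; NonZero; zero; suc)
import Data.Integer.Base as ℤ
import Data.Integer.Properties as ℤ
import Data.Integer.Solver as ℤ
import Data.Sign.Base as Sign
open import Data.Fin.Base as Fin using (Fin; zero; suc; _↑ˡ_; _↑ʳ_)
import Data.Fin.Properties as Fin
open import Data.Product.Base using (Σ; ∃; _×_; _,_; proj₁; proj₂)
open import Data.Sum.Base using (inj₁; inj₂)
open import Data.Empty using (⊥-elim)
open import Data.Unit.Base using (⊤; tt)
open import Data.Maybe.Base using (Maybe; just; nothing)
open import Function.Base using (_∘_; id)
open import Relation.Nullary using (¬_; Dec; yes; no; _×-dec_)
open import Relation.Binary.Structures using (IsDecTotalOrder)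
open import Relation.Binary.PropositionalEquality.Core as ≡ using (_≡_; _≢_)
open import Relation.Unary using (Pred; _∈_; _⊆_; _≐_; _∩_)
open import Algebra.Solver.Ring.AlmostCommutativeRing
  using (fromCommutativeRing; _-Raw-AlmostCommutative⟶_)
import Algebra.Solver.Ring as RingSolver
import Algebra.Properties.Ring as RingProperties
import Algebra.Properties.CommutativeMonoid.Sum as Sums
import Algebra.Properties.Semiring.Sum as SemiringSums
import Algebra.Properties.Semiring.Mult.TCOptimised as Mult
import Relation.Binary.Reasoning.Setoid as SetoidReasoning
open import Defs

-- Case distinctions are available only where the order of the reals decides them, and this shapes
-- the encoding. Membership in a polytope, a span or a component is never decided. Instead, every
-- hull is described by weights on the whole enumeration of the roots, supported on an index set cut
-- out by the decidable conditions `component j ≡ i` and `⟨ v , g j ⟩ ≈ c`. Linear dependence is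
-- decided by the squared length of an orthogonal residual, so bases come from Gram-Schmidt steps.
-- The simple roots enter long before the chamber does: deciding whether each simple coordinate
-- vanishes yields `IsDefinite`, on which every vector identity proved by pairing rests. Relative
-- interiors are defined by balls; the radius around a point with positive weights comes from
-- coordinates that are linear in the displacement, without compactness. An empty `F ∩ 𝔼ᵢ i` has the
-- empty basis and dimension -1, so the dimension count treats it like any other: k - 1 + Σ (nᵢ - 1)
-- = Σ nᵢ - 1.

-- The stdlib ring solver cancels terms only when equality of coefficients is
-- decided by computation, so the coefficients have to be integers.
module IntegerSolver (R : CommutativeRing 0ℓ 0ℓ) where
  open CommutativeRing R
  open RingProperties ring
  open Mult semiring renaming (_×_ to _·_)
  open SetoidReasoning setoid

  embed : ℤ.ℤ → Carrier
  embed (ℤ.+ n)      = n · 1#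
  embed ℤ.-[1+ n ] = - (suc n · 1#)

  embed-neg : ∀ i → embed (ℤ.- i) ≈ - embed i
  embed-neg (ℤ.+ zero)  = sym -0#≈0#
  embed-neg (ℤ.+ suc n) = refl
  embed-neg ℤ.-[1+ n ]  = sym (-‿involutive _)

  cancel-common : ∀ x y z → (x + y) - (x + z) ≈ y - z
  cancel-common x y z = begin
    (x + y) - (x + z)        ≈⟨ +-congˡ (⁻¹-∙-comm x z) ⟨
    (x + y) + (- x + - z)    ≈⟨ +-assoc (x + y) (- x) (- z) ⟨
    ((x + y) + - x) + - z    ≈⟨ +-congʳ (+-congʳ (+-comm x y)) ⟩
    ((y + x) + - x) + - z    ≈⟨ +-congʳ (+-assoc y x (- x)) ⟩
    (y + (x + - x)) + - z    ≈⟨ +-congʳ (+-congˡ (-‿inverseʳ x)) ⟩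
    (y + 0#) + - z           ≈⟨ +-congʳ (+-identityʳ y) ⟩
    y - z                    ∎
    where open import Algebra.Properties.AbelianGroup +-abelianGroup using (⁻¹-∙-comm)

  embed-⊖ : ∀ m n → embed (m ℤ.⊖ n) ≈ m · 1# - n · 1#
  embed-⊖ m       zero    = sym (trans (+-congˡ -0#≈0#) (+-identityʳ _))
  embed-⊖ zero    (suc n) = sym (+-identityˡ _)
  embed-⊖ (suc m) (suc n) = begin
    embed (suc m ℤ.⊖ suc n)            ≈⟨ reflexive (≡.cong embed (ℤ.[1+m]⊖[1+n]≡m⊖n m n)) ⟩
    embed (m ℤ.⊖ n)                    ≈⟨ embed-⊖ m n ⟩
    m · 1# - n · 1#                    ≈⟨ cancel-common 1# _ _ ⟨
    (1# + m · 1#) - (1# + n · 1#)      ≈⟨ +-cong (1+× m 1#) (-‿cong (1+× n 1#)) ⟨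
    suc m · 1# - suc n · 1#            ∎

  embed-+ : ∀ i j → embed (i ℤ.+ j) ≈ embed i + embed j
  embed-+ (ℤ.+ m)    (ℤ.+ n)    = ×-homo-+ 1# m n
  embed-+ (ℤ.+ m)    ℤ.-[1+ n ] = embed-⊖ m (suc n)
  embed-+ ℤ.-[1+ m ] (ℤ.+ n)    = trans (embed-⊖ n (suc m)) (+-comm _ _)
  embed-+ ℤ.-[1+ m ] ℤ.-[1+ n ] = begin
    - (suc (suc (m ℕ.+ n)) · 1#)       ≈⟨ -‿cong (1+× (suc (m ℕ.+ n)) 1#) ⟩
    - (1# + (suc m ℕ.+ n) · 1#)        ≈⟨ -‿cong (+-congˡ (×-homo-+ 1# (suc m) n)) ⟩
    - (1# + (suc m · 1# + n · 1#))     ≈⟨ -‿cong (+-assoc _ _ _) ⟨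
    - ((1# + suc m · 1#) + n · 1#)     ≈⟨ -‿cong (+-congʳ (+-comm _ _)) ⟩
    - ((suc m · 1# + 1#) + n · 1#)     ≈⟨ -‿cong (+-assoc _ _ _) ⟩
    - (suc m · 1# + (1# + n · 1#))     ≈⟨ -‿cong (+-congˡ (1+× n 1#)) ⟨
    - (suc m · 1# + suc n · 1#)        ≈⟨ -‿+-comm _ _ ⟨
    - (suc m · 1#) - suc n · 1#        ∎

  -- Integer multiplication is defined through `◃`, which does not reduce until the absolute value
  -- is known to be zero or a successor.
  embed-◃- : ∀ n → embed (Sign.- ℤ.◃ n) ≈ - (n · 1#)
  embed-◃- zero    = sym -0#≈0#
  embed-◃- (suc n) = refl

  embed-◃+ : ∀ n → embed (Sign.+ ℤ.◃ n) ≈ n · 1#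
  embed-◃+ zero    = refl
  embed-◃+ (suc n) = refl

  embed-* : ∀ i j → embed (i ℤ.* j) ≈ embed i * embed j
  embed-* (ℤ.+ m)    (ℤ.+ n)    = trans (embed-◃+ (m ℕ.* n)) (×1-homo-* m n)
  embed-* (ℤ.+ m)    ℤ.-[1+ n ] = begin
    embed (Sign.- ℤ.◃ (m ℕ.* suc n))   ≈⟨ embed-◃- (m ℕ.* suc n) ⟩
    - ((m ℕ.* suc n) · 1#)             ≈⟨ -‿cong (×1-homo-* m (suc n)) ⟩
    - ((m · 1#) * (suc n · 1#))        ≈⟨ -‿distribʳ-* _ _ ⟩
    (m · 1#) * - (suc n · 1#)          ∎
  embed-* ℤ.-[1+ m ] (ℤ.+ n)    = begin
    embed (Sign.- ℤ.◃ (suc m ℕ.* n))   ≈⟨ embed-◃- (suc m ℕ.* n) ⟩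
    - ((suc m ℕ.* n) · 1#)             ≈⟨ -‿cong (×1-homo-* (suc m) n) ⟩
    - ((suc m · 1#) * (n · 1#))        ≈⟨ -‿distribˡ-* _ _ ⟩
    - (suc m · 1#) * (n · 1#)          ∎
  embed-* ℤ.-[1+ m ] ℤ.-[1+ n ] = begin
    (suc m ℕ.* suc n) · 1#             ≈⟨ ×1-homo-* (suc m) (suc n) ⟩
    (suc m · 1#) * (suc n · 1#)        ≈⟨ -‿involutive _ ⟨
    - (- ((suc m · 1#) * (suc n · 1#)))  ≈⟨ -‿cong (-‿distribˡ-* _ _) ⟩
    - (- (suc m · 1#) * (suc n · 1#))  ≈⟨ -‿distribʳ-* _ _ ⟩
    - (suc m · 1#) * - (suc n · 1#)    ∎

  embedding : ℤ.+-*-rawRing -Raw-AlmostCommutative⟶ fromCommutativeRing R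
  embedding = record
    { ⟦_⟧ = embed ; +-homo = embed-+ ; *-homo = embed-* ; -‿homo = embed-neg
    ; 0-homo = refl ; 1-homo = refl }

  embed-≟ : ∀ i j → Maybe (embed i ≈ embed j)
  embed-≟ i j with i ℤ.≟ j
  ... | yes ≡.refl = just refl
  ... | no _       = nothing

  open RingSolver ℤ.+-*-rawRing (fromCommutativeRing R) embedding embed-≟ public
    using (solve; _:=_; _:+_; _:*_; _:-_; :-_; con)

-- Ordered-field arithmetic and finite sums.

module OrderedField (ℝ : Reals) where
  open Reals ℝ public hiding (zero)
  open IntegerSolver commutativeRing public using (solve; _:=_; _:+_; _:*_; _:-_; :-_; con)
  open IsDecTotalOrder isDecTotalOrder public
    using (_≟_; total; antisym; ≤-respˡ-≈; ≤-respʳ-≈)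
    renaming (refl to ≤-refl; trans to ≤-trans; reflexive to ≤-reflexive)
  open RingProperties ring public using (-0#≈0#)
  open SemiringSums semiring public using (sum-cong-≋; ∑-distrib-+; *-distribˡ-sum; *-distribʳ-sum)
  open SetoidReasoning setoid public

  0≤-resp : ∀ {x y} → x ≈ y → 0# ≤ x → 0# ≤ y
  0≤-resp = ≤-respʳ-≈

  x≤y⇒0≤y-x : ∀ {x y} → x ≤ y → 0# ≤ y - x
  x≤y⇒0≤y-x {x} x≤y = ≤-respˡ-≈ (-‿inverseʳ x) (+-monoˡ-≤ (- x) x≤y)

  0≤y-x⇒x≤y : ∀ {x y} → 0# ≤ y - x → x ≤ y
  0≤y-x⇒x≤y {x} {y} 0≤y-x =
    ≤-respˡ-≈ (+-identityˡ x) (≤-respʳ-≈ (solve 2 (λ a b → (b :- a) :+ a := b) refl x y) (+-monoˡ-≤ x 0≤y-x))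

  ≤-by-difference : ∀ {x y z} → 0# ≤ z → z ≈ y - x → x ≤ y
  ≤-by-difference 0≤z z≈ = 0≤y-x⇒x≤y (0≤-resp z≈ 0≤z)

  +-nonNegative : ∀ {x y} → 0# ≤ x → 0# ≤ y → 0# ≤ x + y
  +-nonNegative {x} {y} 0≤x 0≤y =
    ≤-trans 0≤y (≤-respˡ-≈ (+-identityˡ y) (+-monoˡ-≤ y 0≤x))

  +-mono-≤ : ∀ {x y u v} → x ≤ y → u ≤ v → x + u ≤ y + v
  +-mono-≤ {x} {y} {u} {v} x≤y u≤v = ≤-by-difference
    (+-nonNegative (x≤y⇒0≤y-x x≤y) (x≤y⇒0≤y-x u≤v))
    (solve 4 (λ x y u v → (y :- x) :+ (v :- u) := (y :+ v) :- (x :+ u)) refl x y u v)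

  *-monoˡ-≤ : ∀ {x y z} → 0# ≤ z → x ≤ y → z * x ≤ z * y
  *-monoˡ-≤ {x} {y} {z} 0≤z x≤y = ≤-by-difference (*-nonNegative 0≤z (x≤y⇒0≤y-x x≤y))
    (solve 3 (λ x y z → z :* (y :- x) := z :* y :- z :* x) refl x y z)

  neg-nonNegative : ∀ {x} → x ≤ 0# → 0# ≤ - x
  neg-nonNegative {x} x≤0 = 0≤-resp (+-identityˡ (- x)) (x≤y⇒0≤y-x x≤0)

  square-nonNegative : ∀ x → 0# ≤ x * x
  square-nonNegative x with total 0# x
  ... | inj₁ 0≤x = *-nonNegative 0≤x 0≤x
  ... | inj₂ x≤0 = 0≤-resp (solve 1 (λ x → (:- x) :* (:- x) := x :* x) refl x)
                     (*-nonNegative (neg-nonNegative x≤0) (neg-nonNegative x≤0))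

  0≤1 : 0# ≤ 1#
  0≤1 = 0≤-resp (*-identityˡ 1#) (square-nonNegative 1#)

  0<1 : 0# < 1#
  0<1 = 0≤1 , 0≉1

  positive : ∀ {x} → 0# ≤ x → ¬ (x ≈ 0#) → 0# < x
  positive 0≤x x≉0 = 0≤x , x≉0 ∘ sym

  positive⇒nonZero : ∀ {x} → 0# < x → ¬ (x ≈ 0#)
  positive⇒nonZero (_ , 0≉x) = 0≉x ∘ sym

  0<-resp : ∀ {x y} → x ≈ y → 0# < x → 0# < y
  0<-resp x≈y (0≤x , 0≉x) = 0≤-resp x≈y 0≤x , λ 0≈y → 0≉x (trans 0≈y (sym x≈y))

  0<x≤y⇒0<y : ∀ {x y} → 0# < x → x ≤ y → 0# < y
  0<x≤y⇒0<y (0≤x , 0≉x) x≤y =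
    ≤-trans 0≤x x≤y , λ 0≈y → 0≉x (antisym 0≤x (≤-respʳ-≈ (sym 0≈y) x≤y))

  +-positive : ∀ {x y} → 0# < x → 0# ≤ y → 0# < x + y
  +-positive {x} {y} 0<x 0≤y = 0<x≤y⇒0<y 0<x
    (≤-by-difference 0≤y (solve 2 (λ x y → y := (x :+ y) :- x) refl x y))

  *-cancel-nonZero : ∀ {x y} → ¬ (x ≈ 0#) → x * y ≈ 0# → y ≈ 0#
  *-cancel-nonZero {x} {y} x≉0 xy≈0 = begin
    y                  ≈⟨ *-identityˡ y ⟨
    1# * y             ≈⟨ *-congʳ (⁻¹-inverseʳ x≉0) ⟨
    (x * x ⁻¹) * y     ≈⟨ solve 3 (λ x i y → (x :* i) :* y := i :* (x :* y)) refl x (x ⁻¹) y ⟩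
    x ⁻¹ * (x * y)     ≈⟨ *-congˡ xy≈0 ⟩
    x ⁻¹ * 0#          ≈⟨ zeroʳ _ ⟩
    0#                 ∎

  *-positive : ∀ {x y} → 0# < x → 0# < y → 0# < x * y
  *-positive 0<x 0<y = positive (*-nonNegative (proj₁ 0<x) (proj₁ 0<y))
    λ xy≈0 → positive⇒nonZero 0<y (*-cancel-nonZero (positive⇒nonZero 0<x) xy≈0)

  ⁻¹-inverseˡ : ∀ {x} → ¬ (x ≈ 0#) → x ⁻¹ * x ≈ 1#
  ⁻¹-inverseˡ x≉0 = trans (*-comm _ _) (⁻¹-inverseʳ x≉0)

  ⁻¹-nonZero : ∀ {x} → ¬ (x ≈ 0#) → ¬ (x ⁻¹ ≈ 0#)
  ⁻¹-nonZero {x} x≉0 i≈0 = 0≉1 (trans (sym (zeroʳ x)) (trans (*-congˡ (sym i≈0)) (⁻¹-inverseʳ x≉0)))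

  ⁻¹-positive : ∀ {x} → 0# < x → 0# < x ⁻¹
  ⁻¹-positive {x} 0<x = positive (0≤-resp eq
      (*-nonNegative (proj₁ 0<x) (square-nonNegative (x ⁻¹)))) (⁻¹-nonZero x≉0)
    where
    x≉0 = positive⇒nonZero 0<x
    eq : x * (x ⁻¹ * x ⁻¹) ≈ x ⁻¹
    eq = trans (sym (*-assoc _ _ _)) (trans (*-congʳ (⁻¹-inverseʳ x≉0)) (*-identityˡ _))

  *-cancelˡ-≤ : ∀ {x y z} → 0# < z → z * x ≤ z * y → x ≤ y
  *-cancelˡ-≤ {x} {y} {z} 0<z zx≤zy =
    ≤-respˡ-≈ (cancel x) (≤-respʳ-≈ (cancel y) (*-monoˡ-≤ (proj₁ (⁻¹-positive 0<z)) zx≤zy))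
    where
    cancel : ∀ w → z ⁻¹ * (z * w) ≈ w
    cancel w = trans (sym (*-assoc _ _ _)) (trans (*-congʳ (⁻¹-inverseˡ (positive⇒nonZero 0<z))) (*-identityˡ w))

  *-cancelˡ-nonZero : ∀ {x y z} → ¬ (z ≈ 0#) → z * x ≈ z * y → x ≈ y
  *-cancelˡ-nonZero {x} {y} {z} z≉0 zx≈zy = begin
    x              ≈⟨ solve 2 (λ x y → x := (x :- y) :+ y) refl x y ⟩
    (x - y) + y
      ≈⟨ +-congʳ (*-cancel-nonZero z≉0 (trans (solve 3 (λ x y z → z :* (x :- y) := z :* x :- z :* y) refl x y z)
                        (trans (+-congʳ zx≈zy) (-‿inverseʳ _)))) ⟩
    0# + y         ≈⟨ +-identityˡ y ⟩
    y              ∎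

  2# ½ : Carrier
  2# = 1# + 1#
  ½  = 2# ⁻¹

  0<2 : 0# < 2#
  0<2 = +-positive 0<1 0≤1

  0<½ : 0# < ½
  0<½ = ⁻¹-positive 0<2

  ½+½≈1 : ½ + ½ ≈ 1#
  ½+½≈1 = trans (solve 1 (λ h → h :+ h := (con ℤ.1ℤ :+ con ℤ.1ℤ) :* h) refl ½) (⁻¹-inverseʳ (positive⇒nonZero 0<2))

  sum-cong : ∀ {n} {a b : Fin n → Carrier} → (∀ j → a j ≈ b j) → sum a ≈ sum b
  sum-cong = sum-cong-≋

  sum-zero : ∀ {n} {a : Fin n → Carrier} → (∀ j → a j ≈ 0#) → sum a ≈ 0#
  sum-zero {zero}  a≈0 = refl
  sum-zero {suc n} a≈0 = trans (+-cong (a≈0 zero) (sum-zero (a≈0 ∘ suc))) (+-identityˡ 0#)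

  sum-nonNegative : ∀ {n} {a : Fin n → Carrier} → (∀ j → 0# ≤ a j) → 0# ≤ sum a
  sum-nonNegative {zero}  0≤a = ≤-refl
  sum-nonNegative {suc n} 0≤a = +-nonNegative (0≤a zero) (sum-nonNegative (0≤a ∘ suc))

  sum-mono-≤ : ∀ {n} {a b : Fin n → Carrier} → (∀ j → a j ≤ b j) → sum a ≤ sum b
  sum-mono-≤ {zero}  a≤b = ≤-refl
  sum-mono-≤ {suc n} a≤b = +-mono-≤ (a≤b zero) (sum-mono-≤ (a≤b ∘ suc))

  term≤sum : ∀ {n} {a : Fin n → Carrier} → (∀ j → 0# ≤ a j) → ∀ j → a j ≤ sum a
  term≤sum {suc n} {a} 0≤a zero = ≤-by-difference (sum-nonNegative (0≤a ∘ suc))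
    (solve 2 (λ x y → y := (x :+ y) :- x) refl (a zero) _)
  term≤sum {suc n} {a} 0≤a (suc j) = ≤-trans (term≤sum (0≤a ∘ suc) j)
    (≤-by-difference (0≤a zero) (solve 2 (λ x y → x := (x :+ y) :- y) refl (a zero) _))

  sum≈0⇒term≈0 : ∀ {n} {a : Fin n → Carrier} → (∀ j → 0# ≤ a j) → sum a ≈ 0# → ∀ j → a j ≈ 0#
  sum≈0⇒term≈0 0≤a s≈0 j = antisym (≤-respʳ-≈ s≈0 (term≤sum 0≤a j)) (0≤a j)

  -- Decidable equality with zero permits a search for the witness, which later supplies a generator
  -- in the support of a combination.
  sum-nonZero : ∀ {n} (a : Fin n → Carrier) → ¬ (sum a ≈ 0#) → ∃ λ j → ¬ (a j ≈ 0#)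
  sum-nonZero {zero}  a s≉0 = ⊥-elim (s≉0 refl)
  sum-nonZero {suc n} a s≉0 with a zero ≟ 0#
  ... | no  a≉0 = zero , a≉0
  ... | yes a≈0 with sum-nonZero (a ∘ suc) (λ s≈0 → s≉0 (trans (+-cong a≈0 s≈0) (+-identityˡ 0#)))
  ...   | j , aj≉0 = suc j , aj≉0

  sum-- : ∀ {n} (a b : Fin n → Carrier) → sum (λ j → a j - b j) ≈ sum a - sum b
  sum-- {zero}  a b = sym (-‿inverseʳ 0#)
  sum-- {suc n} a b = trans (+-congˡ (sum-- (a ∘ suc) (b ∘ suc)))
    (solve 4 (λ x y u v → (x :- y) :+ (u :- v) := (x :+ u) :- (y :+ v)) refl (a zero) (b zero) _ _)

  δ : ∀ {n} → Fin n → Fin n → Carrier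
  δ zero    zero    = 1#
  δ zero    (suc _) = 0#
  δ (suc _) zero    = 0#
  δ (suc i) (suc j) = δ i j

  δ-nonNegative : ∀ {n} (i j : Fin n) → 0# ≤ δ i j
  δ-nonNegative zero    zero    = 0≤1
  δ-nonNegative zero    (suc _) = ≤-refl
  δ-nonNegative (suc _) zero    = ≤-refl
  δ-nonNegative (suc i) (suc j) = δ-nonNegative i j

  δ-offDiagonal : ∀ {n} {i j : Fin n} → i ≢ j → δ i j ≈ 0#
  δ-offDiagonal {i = zero}  {zero}  i≢j = ⊥-elim (i≢j ≡.refl)
  δ-offDiagonal {i = zero}  {suc _} i≢j = refl
  δ-offDiagonal {i = suc _} {zero}  i≢j = refl
  δ-offDiagonal {i = suc i} {suc j} i≢j = δ-offDiagonal (i≢j ∘ ≡.cong suc)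

  δ-diagonal : ∀ {n} (i : Fin n) → δ i i ≈ 1#
  δ-diagonal zero    = refl
  δ-diagonal (suc i) = δ-diagonal i

  sum-δ : ∀ {n} (i : Fin n) (f : Fin n → Carrier) → sum (λ j → δ i j * f j) ≈ f i
  sum-δ zero    f = trans (+-cong (*-identityˡ _) (sum-zero {a = λ j → 0# * f (suc j)} λ j → zeroˡ _)) (+-identityʳ _)
  sum-δ (suc i) f = trans (+-cong (zeroˡ _) (sum-δ i (f ∘ suc))) (+-identityˡ _)

  sum-δ₁ : ∀ {n} (i : Fin n) → sum (δ i) ≈ 1#
  sum-δ₁ i = trans (sum-cong λ j → sym (*-identityʳ (δ i j))) (sum-δ i λ _ → 1#)

  restrict : ∀ {P : Set} → Dec P → Carrier → Carrier
  restrict (yes _) x = x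
  restrict (no _)  x = 0#

  restrict-yes : ∀ {P : Set} (P? : Dec P) {x} → P → restrict P? x ≈ x
  restrict-yes (yes _) p = refl
  restrict-yes (no ¬p) p = ⊥-elim (¬p p)

  restrict-no : ∀ {P : Set} (P? : Dec P) {x} → ¬ P → restrict P? x ≈ 0#
  restrict-no (yes p) ¬p = ⊥-elim (¬p p)
  restrict-no (no _)  ¬p = refl

  restrict-nonNegative : ∀ {P : Set} (P? : Dec P) {x} → 0# ≤ x → 0# ≤ restrict P? x
  restrict-nonNegative (yes _) 0≤x = 0≤x
  restrict-nonNegative (no _)  0≤x = ≤-refl

  restrict-≤ : ∀ {P : Set} (P? : Dec P) {x} → 0# ≤ x → restrict P? x ≤ x
  restrict-≤ (yes _) 0≤x = ≤-refl
  restrict-≤ (no _)  0≤x = 0≤x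

  -- The minimum of finitely many radii: the smaller of two inherits the condition of the larger by
  -- monotonicity.
  common-radius : ∀ {n} {P : Fin n → Carrier → Set} →
    (∀ j {ε ε′} → 0# < ε → ε ≤ ε′ → P j ε′ → P j ε) →
    (∀ j → ∃ λ ε → 0# < ε × P j ε) → ∃ λ ε → 0# < ε × (∀ j → P j ε)
  common-radius {zero}  mono h = 1# , 0<1 , λ ()
  common-radius {suc n} {P} mono h with h zero | common-radius {P = P ∘ suc} (mono ∘ suc) (h ∘ suc)
  ... | ε , 0<ε , p | η , 0<η , q with total ε η
  ...   | inj₁ ε≤η = ε , 0<ε , λ { zero → p ; (suc j) → mono (suc j) 0<ε ε≤η (q j) }
  ...   | inj₂ η≤ε = η , 0<η , λ { zero → mono zero 0<η η≤ε p ; (suc j) → q j }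

-- Bilinearity and linear combinations.

module InnerProduct {ℝ : Reals} (E : EuclideanSpace ℝ) where
  open OrderedField ℝ public
  open EuclideanSpace E public
  open Geometry E public

  IsDefinite : Set
  IsDefinite = ∀ x → ⟨ x , x ⟩ ≈ 0# → x ≈ᴹ 0ᴹ

  ⟨⟩-congˡ : ∀ {x y} z → x ≈ᴹ y → ⟨ x , z ⟩ ≈ ⟨ y , z ⟩
  ⟨⟩-congˡ z x≈y = ⟨⟩-cong x≈y ≈ᴹ-refl

  ⟨⟩-congʳ : ∀ {x y} z → x ≈ᴹ y → ⟨ z , x ⟩ ≈ ⟨ z , y ⟩
  ⟨⟩-congʳ z x≈y = ⟨⟩-cong ≈ᴹ-refl x≈y

  ⟨⟩-zeroˡ : ∀ z → ⟨ 0ᴹ , z ⟩ ≈ 0#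
  ⟨⟩-zeroˡ z = begin
    ⟨ 0ᴹ , z ⟩          ≈⟨ ⟨⟩-congˡ z (*ₗ-zeroˡ 0ᴹ) ⟨
    ⟨ 0# *ₗ 0ᴹ , z ⟩    ≈⟨ ⟨⟩-homogeneousˡ 0# 0ᴹ z ⟩
    0# * ⟨ 0ᴹ , z ⟩     ≈⟨ zeroˡ _ ⟩
    0#                  ∎

  ⟨⟩-negˡ : ∀ x z → ⟨ -ᴹ x , z ⟩ ≈ - ⟨ x , z ⟩
  ⟨⟩-negˡ x z = begin
    ⟨ -ᴹ x , z ⟩                              ≈⟨ solve 2 (λ a b → a := (b :+ a) :- b) refl _ _ ⟩
    (⟨ x , z ⟩ + ⟨ -ᴹ x , z ⟩) - ⟨ x , z ⟩    ≈⟨ +-congʳ (⟨⟩-additiveˡ x (-ᴹ x) z) ⟨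
    ⟨ x +ᴹ -ᴹ x , z ⟩ - ⟨ x , z ⟩             ≈⟨ +-congʳ (trans (⟨⟩-congˡ z (-ᴹ‿inverseʳ x)) (⟨⟩-zeroˡ z)) ⟩
    0# - ⟨ x , z ⟩                            ≈⟨ +-identityˡ _ ⟩
    - ⟨ x , z ⟩                               ∎

  ⟨⟩-minusˡ : ∀ x y z → ⟨ x -ᴹ y , z ⟩ ≈ ⟨ x , z ⟩ - ⟨ y , z ⟩
  ⟨⟩-minusˡ x y z = trans (⟨⟩-additiveˡ x (-ᴹ y) z) (+-congˡ (⟨⟩-negˡ y z))

  ⟨⟩-combinationˡ : ∀ {n} (c : Fin n → Carrier) p z →
    ⟨ combination c p , z ⟩ ≈ sum (λ j → c j * ⟨ p j , z ⟩)
  ⟨⟩-combinationˡ {zero}  c p z = ⟨⟩-zeroˡ z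
  ⟨⟩-combinationˡ {suc n} c p z = trans (⟨⟩-additiveˡ _ _ z)
    (+-cong (⟨⟩-homogeneousˡ _ _ z) (⟨⟩-combinationˡ (c ∘ suc) (p ∘ suc) z))

  ⟨⟩-additiveʳ : ∀ z x y → ⟨ z , x +ᴹ y ⟩ ≈ ⟨ z , x ⟩ + ⟨ z , y ⟩
  ⟨⟩-additiveʳ z x y = trans (⟨⟩-symmetric z _)
    (trans (⟨⟩-additiveˡ x y z) (+-cong (⟨⟩-symmetric x z) (⟨⟩-symmetric y z)))

  ⟨⟩-homogeneousʳ : ∀ c z x → ⟨ z , c *ₗ x ⟩ ≈ c * ⟨ z , x ⟩
  ⟨⟩-homogeneousʳ c z x = trans (⟨⟩-symmetric z _)
    (trans (⟨⟩-homogeneousˡ c x z) (*-congˡ (⟨⟩-symmetric x z)))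

  ⟨⟩-minusʳ : ∀ z x y → ⟨ z , x -ᴹ y ⟩ ≈ ⟨ z , x ⟩ - ⟨ z , y ⟩
  ⟨⟩-minusʳ z x y = trans (⟨⟩-symmetric z _)
    (trans (⟨⟩-minusˡ x y z) (+-cong (⟨⟩-symmetric x z) (-‿cong (⟨⟩-symmetric y z))))

  ⟨⟩-combinationʳ : ∀ {n} (c : Fin n → Carrier) p z →
    ⟨ z , combination c p ⟩ ≈ sum (λ j → c j * ⟨ z , p j ⟩)
  ⟨⟩-combinationʳ c p z = trans (⟨⟩-symmetric z _)
    (trans (⟨⟩-combinationˡ c p z) (sum-cong λ j → *-congˡ (⟨⟩-symmetric (p j) z)))

  orthogonal-combination : ∀ {n} {w} (c : Fin n → Carrier) p →
    (∀ j → ⟨ w , p j ⟩ ≈ 0#) → ⟨ w , combination c p ⟩ ≈ 0#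
  orthogonal-combination {w = w} c p w⊥p = trans (⟨⟩-combinationʳ c p w)
    (sum-zero λ j → trans (*-congˡ (w⊥p j)) (zeroʳ (c j)))

  combination-cong : ∀ {n} {a b : Fin n → Carrier} {p q : Fin n → Carrierᴹ} →
    (∀ j → a j *ₗ p j ≈ᴹ b j *ₗ q j) → combination a p ≈ᴹ combination b q
  combination-cong = Sums.sum-cong-≋ +ᴹ-commutativeMonoid

  combination-+ : ∀ {n} (a b : Fin n → Carrier) p →
    combination (λ j → a j + b j) p ≈ᴹ combination a p +ᴹ combination b p
  combination-+ a b p = ≈ᴹ-trans
    (Sums.sum-cong-≋ +ᴹ-commutativeMonoid (λ j → *ₗ-distribʳ (p j) (a j) (b j)))
    (Sums.∑-distrib-+ +ᴹ-commutativeMonoid (λ j → a j *ₗ p j) (λ j → b j *ₗ p j))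

  combination-* : ∀ {n} s (a : Fin n → Carrier) p →
    combination (λ j → s * a j) p ≈ᴹ s *ₗ combination a p
  combination-* {zero}  s a p = ≈ᴹ-sym (*ₗ-zeroʳ s)
  combination-* {suc n} s a p = ≈ᴹ-trans
    (+ᴹ-cong (*ₗ-assoc s (a zero) (p zero)) (combination-* s (a ∘ suc) (p ∘ suc)))
    (≈ᴹ-sym (*ₗ-distribˡ s _ _))

  combination-zero : ∀ {n} {a : Fin n → Carrier} p → (∀ j → a j ≈ 0#) → combination a p ≈ᴹ 0ᴹ
  combination-zero {zero}  p a≈0 = ≈ᴹ-refl
  combination-zero {suc n} p a≈0 = ≈ᴹ-trans
    (+ᴹ-cong (≈ᴹ-trans (*ₗ-congʳ (a≈0 zero)) (*ₗ-zeroˡ (p zero))) (combination-zero (p ∘ suc) (a≈0 ∘ suc)))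
    (+ᴹ-identityˡ 0ᴹ)

  -- `W` sees the partial weight together with the partial sum: points of an affine or convex hull
  -- are not closed under addition, but such pairs are.
  combination-closed : (W : Carrier → Carrierᴹ → Set) → W 0# 0ᴹ →
    (∀ {s t x y} → W s x → W t y → W (s + t) (x +ᴹ y)) →
    ∀ {n} (c : Fin n → Carrier) p → (∀ j → W (c j) (c j *ₗ p j)) →
    W (sum c) (combination c p)
  combination-closed W W₀ W₊ {zero}  c p h = W₀
  combination-closed W W₀ W₊ {suc n} c p h =
    W₊ (h zero) (combination-closed W W₀ W₊ (c ∘ suc) (p ∘ suc) (h ∘ suc))

  -- Syntax for vector expressions. `pairing` turns an expression into a scalar, so that an identity
  -- of vectors becomes a goal for the ring solver.
  data Expr : Set where
    ↑_      : Carrierᴹ → Expr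
    _⊕_ _⊝_ : Expr → Expr → Expr
    _⊙_     : Carrier → Expr → Expr
    𝟎       : Expr

  infix  8 ↑_
  infixr 7 _⊙_
  infixl 6 _⊕_ _⊝_

  ⟦_⟧ : Expr → Carrierᴹ
  ⟦ ↑ x ⟧   = x
  ⟦ e ⊕ f ⟧ = ⟦ e ⟧ +ᴹ ⟦ f ⟧
  ⟦ e ⊝ f ⟧ = ⟦ e ⟧ -ᴹ ⟦ f ⟧
  ⟦ c ⊙ e ⟧ = c *ₗ ⟦ e ⟧
  ⟦ 𝟎 ⟧     = 0ᴹ

  pairing : Expr → Carrierᴹ → Carrier
  pairing (↑ x)   z = ⟨ x , z ⟩
  pairing (e ⊕ f) z = pairing e z + pairing f z
  pairing (e ⊝ f) z = pairing e z - pairing f z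
  pairing (c ⊙ e) z = c * pairing e z
  pairing 𝟎       z = 0#

  pairing-correct : ∀ e z → ⟨ ⟦ e ⟧ , z ⟩ ≈ pairing e z
  pairing-correct (↑ x)   z = refl
  pairing-correct (e ⊕ f) z = trans (⟨⟩-additiveˡ _ _ z) (+-cong (pairing-correct e z) (pairing-correct f z))
  pairing-correct (e ⊝ f) z = trans (⟨⟩-minusˡ _ _ z) (+-cong (pairing-correct e z) (-‿cong (pairing-correct f z)))
  pairing-correct (c ⊙ e) z = trans (⟨⟩-homogeneousˡ _ _ z) (*-congˡ (pairing-correct e z))
  pairing-correct 𝟎       z = ⟨⟩-zeroˡ z

-- Under the Reals axioms positive definiteness only gives the double negation
-- of x ≈ᴹ 0ᴹ for a null vector x, hence the extra hypothesis.
module Definite {ℝ : Reals} (E : EuclideanSpace ℝ)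
  (definite : InnerProduct.IsDefinite E) where
  open InnerProduct E public

  ⟨x,x⟩≥0 : ∀ x → 0# ≤ ⟨ x , x ⟩
  ⟨x,x⟩≥0 x with ⟨ x , x ⟩ ≟ 0#
  ... | yes ≈0 = ≤-reflexive (sym ≈0)
  ... | no ≉0  = proj₁ (positiveDefinite x λ x≈0 → ≉0 (trans (⟨⟩-congˡ x x≈0) (⟨⟩-zeroˡ x)))

  x-y≈0⇒x≈y : ∀ {x y} → x -ᴹ y ≈ᴹ 0ᴹ → x ≈ᴹ y
  x-y≈0⇒x≈y {x} {y} x-y≈0 = ≈ᴹ-trans (≈ᴹ-sym (+ᴹ-identityʳ x))
    (≈ᴹ-trans (+ᴹ-congˡ (≈ᴹ-sym (-ᴹ‿inverseˡ y))) (≈ᴹ-trans (≈ᴹ-sym (+ᴹ-assoc x (-ᴹ y) y))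
    (≈ᴹ-trans (+ᴹ-congʳ x-y≈0) (+ᴹ-identityˡ y))))

  ext : ∀ {x y} → (∀ z → ⟨ x , z ⟩ ≈ ⟨ y , z ⟩) → x ≈ᴹ y
  ext {x} {y} eq = x-y≈0⇒x≈y (definite _
    (trans (⟨⟩-minusˡ x y _) (trans (+-congʳ (eq _)) (-‿inverseʳ _))))

  -- Nondegeneracy reduces an identity of vectors to a ring identity of scalars.
  linear : ∀ e f → (∀ z → pairing e z ≈ pairing f z) → ⟦ e ⟧ ≈ᴹ ⟦ f ⟧
  linear e f eq = ext λ z → trans (pairing-correct e z) (trans (eq z) (sym (pairing-correct f z)))

  combination-δ : ∀ {n} (i : Fin n) p → combination (δ i) p ≈ᴹ p i
  combination-δ i p = ext λ z → trans (⟨⟩-combinationˡ (δ i) p z) (sum-δ i λ j → ⟨ p j , z ⟩)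

  -- Affine and convex hulls differ only in the sign condition on the weights, so both are treated
  -- at once.
  data Kind : Set where
    affine convex : Kind

  Admissible : Kind → Carrier → Set
  Admissible affine _ = ⊤
  Admissible convex c = 0# ≤ c

  admissible-0 : ∀ κ → Admissible κ 0#
  admissible-0 affine = tt
  admissible-0 convex = ≤-refl

  admissible-1 : ∀ κ → Admissible κ 1#
  admissible-1 affine = tt
  admissible-1 convex = 0≤1

  admissible-+ : ∀ κ {x y} → Admissible κ x → Admissible κ y → Admissible κ (x + y)
  admissible-+ affine _ _ = tt
  admissible-+ convex = +-nonNegative

  admissible-* : ∀ κ {x y} → Admissible κ x → Admissible κ y → Admissible κ (x * y)
  admissible-* affine _ _ = tt
  admissible-* convex = *-nonNegative

  admissible-δ : ∀ κ {n} (i j : Fin n) → Admissible κ (δ i j)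
  admissible-δ affine i j = tt
  admissible-δ convex i j = δ-nonNegative i j

  hull : Kind → Subset → Subset
  hull affine = affineHull
  hull convex = convexHull

  hull-intro : ∀ κ {S} {n} (c : Fin n → Carrier) p {x} → (∀ j → p j ∈ S) →
    (∀ j → Admissible κ (c j)) → sum c ≈ 1# → x ≈ᴹ combination c p → x ∈ hull κ S
  hull-intro affine c p p∈S _   s≈1 x≈ = _ , c , p , p∈S , s≈1 , x≈
  hull-intro convex c p p∈S 0≤c s≈1 x≈ = _ , c , p , p∈S , 0≤c , s≈1 , x≈

  hull-elim : ∀ κ {S} (W : Carrier → Carrierᴹ → Set) →
    (∀ {s t x y} → s ≈ t → x ≈ᴹ y → W s x → W t y) → W 0# 0ᴹ →
    (∀ {s t x y} → W s x → W t y → W (s + t) (x +ᴹ y)) →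
    (∀ {c y} → Admissible κ c → y ∈ S → W c (c *ₗ y)) →
    ∀ {x} → x ∈ hull κ S → W 1# x
  hull-elim affine W resp W₀ W₊ W* (n , c , p , p∈S , s≈1 , x≈) =
    resp s≈1 (≈ᴹ-sym x≈) (combination-closed W W₀ W₊ c p λ j → W* tt (p∈S j))
  hull-elim convex W resp W₀ W₊ W* (n , c , p , p∈S , 0≤c , s≈1 , x≈) =
    resp s≈1 (≈ᴹ-sym x≈) (combination-closed W W₀ W₊ c p λ j → W* (0≤c j) (p∈S j))

  hull-extensive : ∀ κ {S x} → x ∈ S → x ∈ hull κ S
  hull-extensive κ {x = x} x∈S = hull-intro κ {n = 1} (λ _ → 1#) (λ _ → x) (λ _ → x∈S)
    (λ _ → admissible-1 κ) (+-identityʳ 1#)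
    (≈ᴹ-sym (≈ᴹ-trans (+ᴹ-identityʳ _) (*ₗ-identityˡ x)))

  -- Weights on a fixed finite family of generators.

  module Family {n} (g : Fin n → Carrierᴹ) where

    -- Hulls of the subfamilies of g are described by weights on all of g that
    -- vanish off the index set J of the subfamily.
    record Comb (κ : Kind) (J : Pred (Fin n) 0ℓ) (t : Carrier) (x : Carrierᴹ) : Set where
      constructor comb
      field
        weights    : Fin n → Carrier
        supported  : ∀ j → ¬ J j → weights j ≈ 0#
        admissible : ∀ j → Admissible κ (weights j)
        total      : sum weights ≈ t
        point      : x ≈ᴹ combination weights g
    open Comb public

    module _ {κ : Kind} {J : Pred (Fin n) 0ℓ} where

      Comb-resp : ∀ {s t x y} → s ≈ t → x ≈ᴹ y → Comb κ J s x → Comb κ J t y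
      Comb-resp s≈t x≈y (comb a off adm sum≈ x≈) =
        comb a off adm (trans sum≈ s≈t) (≈ᴹ-trans (≈ᴹ-sym x≈y) x≈)

      Comb-0 : Comb κ J 0# 0ᴹ
      Comb-0 = comb (λ _ → 0#) (λ _ _ → refl) (λ _ → admissible-0 κ) (sum-zero {n} (λ _ → refl))
        (≈ᴹ-sym (combination-zero g λ _ → refl))

      Comb-+ : ∀ {s t x y} → Comb κ J s x → Comb κ J t y → Comb κ J (s + t) (x +ᴹ y)
      Comb-+ (comb a offa adma suma x≈) (comb b offb admb sumb y≈) = comb
        (λ j → a j + b j)
        (λ j j∉J → trans (+-cong (offa j j∉J) (offb j j∉J)) (+-identityˡ 0#))
        (λ j → admissible-+ κ (adma j) (admb j))
        (trans (∑-distrib-+ a b) (+-cong suma sumb))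
        (≈ᴹ-trans (+ᴹ-cong x≈ y≈) (≈ᴹ-sym (combination-+ a b g)))

      Comb-* : ∀ {s t x} → Admissible κ s → Comb κ J t x → Comb κ J (s * t) (s *ₗ x)
      Comb-* {s} adms (comb a off adm suma x≈) = comb
        (λ j → s * a j)
        (λ j j∉J → trans (*-congˡ (off j j∉J)) (zeroʳ s))
        (λ j → admissible-* κ adms (adm j))
        (trans (sym (*-distribˡ-sum s a)) (*-congˡ suma))
        (≈ᴹ-trans (*ₗ-congˡ x≈) (≈ᴹ-sym (combination-* s a g)))

      Comb-generator : ∀ {j} → J j → Comb κ J 1# (g j)
      Comb-generator {j} j∈J = comb (δ j) (λ i i∉J → δ-offDiagonal {i = j} {i} λ { ≡.refl → i∉J j∈J })
        (admissible-δ κ j) (sum-δ₁ j) (≈ᴹ-sym (combination-δ j g))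

      Comb-mono : ∀ {J′ : Pred (Fin n) 0ℓ} {t x} → (∀ {j} → J j → J′ j) → Comb κ J t x → Comb κ J′ t x
      Comb-mono J⊆J′ (comb a off adm suma x≈) = comb a (λ j j∉J′ → off j (j∉J′ ∘ J⊆J′)) adm suma x≈

      hull⊆Comb : ∀ {S} → (∀ {y} → y ∈ S → Comb κ J 1# y) → ∀ {x} → x ∈ hull κ S → Comb κ J 1# x
      hull⊆Comb S⊆ = hull-elim κ (Comb κ J) Comb-resp Comb-0 Comb-+
        λ adm y∈S → Comb-resp (*-identityʳ _) ≈ᴹ-refl (Comb-* adm (S⊆ y∈S))

      -- Weights of total one cannot all vanish, and a nonzero weight can only sit on `J`.
      support : (∀ j → Dec (J j)) → ∀ {x} → Comb κ J 1# x → ∃ J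
      support J? (comb a off _ sum≈1 _)
        with sum-nonZero a (λ s≈0 → 0≉1 (trans (sym s≈0) sum≈1))
      ... | j , aj≉0 with J? j
      ...   | yes j∈J = j , j∈J
      ...   | no  j∉J = ⊥-elim (aj≉0 (off j j∉J))

      -- Generators off `J` have weight zero but may lie outside `S`; each is replaced by one fixed
      -- generator from `J`, which exists because the total weight is one.
      Comb⊆hull : (∀ j → Dec (J j)) → ∀ {S} → (∀ {j} → J j → g j ∈ S) →
                  ∀ {x} → Comb κ J 1# x → x ∈ hull κ S
      Comb⊆hull J? {S} g∈S cx@(comb a off adm sum≈1 x≈) =
        hull-intro κ a p p∈S adm sum≈1 (≈ᴹ-trans x≈ (combination-cong same))
        where
        j₀ = support J? cx
        p : Fin n → Carrierᴹ
        p j with J? j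
        ... | yes _ = g j
        ... | no  _ = g (proj₁ j₀)
        p∈S : ∀ j → p j ∈ S
        p∈S j with J? j
        ... | yes j∈J = g∈S j∈J
        ... | no  _   = g∈S (proj₂ j₀)
        same : ∀ j → a j *ₗ g j ≈ᴹ a j *ₗ p j
        same j with J? j
        ... | yes _   = ≈ᴹ-refl
        ... | no  j∉J = ≈ᴹ-trans (zero-scale (g j)) (≈ᴹ-sym (zero-scale _))
          where
          zero-scale : ∀ y → a j *ₗ y ≈ᴹ 0ᴹ
          zero-scale y = ≈ᴹ-trans (*ₗ-congʳ (off j j∉J)) (*ₗ-zeroˡ y)

    Comb-affine : ∀ {J t x} → Comb convex J t x → Comb affine J t x
    Comb-affine (comb a off _ suma x≈) = comb a off _ suma x≈

    span⊆Comb : ∀ {J S} → (∀ {y} → y ∈ S → Comb affine J 1# y) →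
                ∀ {x} → x ∈ span S → ∃ λ t → Comb affine J t x
    span⊆Comb {J} S⊆ (_ , c , p , p∈S , x≈) = sum c , Comb-resp refl (≈ᴹ-sym x≈)
      (combination-closed (Comb affine J) Comb-0 Comb-+ c p
        λ j → Comb-resp (*-identityʳ _) ≈ᴹ-refl (Comb-* tt (S⊆ (p∈S j))))

-- Orthogonal projections and selection of bases.

module Convexity {ℝ : Reals} (E : EuclideanSpace ℝ)
  (definite : InnerProduct.IsDefinite E) where
  open Definite E definite public

  residual : ∀ {n} → (d p : Fin n → Carrierᴹ) → Carrierᴹ → Carrierᴹ
  residual d p u = u -ᴹ combination (λ l → ⟨ d l , u ⟩) p

  pairing-residual : ∀ {n} (d p : Fin n → Carrierᴹ) u z →
    ⟨ residual d p u , z ⟩ ≈ ⟨ u , z ⟩ - sum (λ l → ⟨ d l , u ⟩ * ⟨ p l , z ⟩)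
  pairing-residual d p u z = trans (⟨⟩-minusˡ _ _ z) (+-congˡ (-‿cong (⟨⟩-combinationˡ _ p z)))

  sum-minus-multiple : ∀ {n} (a b c : Fin n → Carrier) s →
    sum (λ l → (a l - b l * s) * c l) ≈ sum (λ l → a l * c l) - s * sum (λ l → b l * c l)
  sum-minus-multiple a b c s = begin
    sum (λ l → (a l - b l * s) * c l)
      ≈⟨ sum-cong (λ l → solve 4 (λ a b c s → (a :- b :* s) :* c := a :* c :- s :* (b :* c)) refl (a l) (b l) (c l) s) ⟩
    sum (λ l → a l * c l - s * (b l * c l))                 ≈⟨ sum-- (λ l → a l * c l) (λ l → s * (b l * c l)) ⟩
    sum (λ l → a l * c l) - sum (λ l → s * (b l * c l))     ≈⟨ +-congˡ (-‿cong (*-distribˡ-sum s (λ l → b l * c l))) ⟨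
    sum (λ l → a l * c l) - s * sum (λ l → b l * c l)       ∎

  -- u ↦ Σ ⟨ d l , u ⟩ p l is the orthogonal projection onto the span of p, which
  -- need not be independent.
  dual-family : ∀ {n} (p : Fin n → Carrierᴹ) →
    Σ (Fin n → Carrierᴹ) λ d → ∀ u j → ⟨ residual d p u , p j ⟩ ≈ 0#
  dual-family {zero}  p = (λ ()) , λ _ ()
  dual-family {suc n} p with dual-family (p ∘ suc)
  ... | d , d-dual with ⟨ residual d (p ∘ suc) (p zero) , residual d (p ∘ suc) (p zero) ⟩ ≟ 0#
  ...   | yes N≈0 = d⁺ , orthogonal
    where
    r₀ = residual d (p ∘ suc) (p zero)
    -- Here `p zero` lies in the span of the other vectors, so its coefficient can be zero.
    d⁺ : Fin (suc n) → Carrierᴹ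
    d⁺ zero    = 0ᴹ
    d⁺ (suc l) = d l
    same : ∀ u z → ⟨ residual d⁺ p u , z ⟩ ≈ ⟨ residual d (p ∘ suc) u , z ⟩
    same u z = begin
      ⟨ residual d⁺ p u , z ⟩         ≈⟨ pairing-residual d⁺ p u z ⟩
      ⟨ u , z ⟩ - (⟨ 0ᴹ , u ⟩ * ⟨ p zero , z ⟩ + S)
        ≈⟨ +-congˡ (-‿cong (+-congʳ (trans (*-congʳ (⟨⟩-zeroˡ u)) (zeroˡ _)))) ⟩
      ⟨ u , z ⟩ - (0# + S)            ≈⟨ +-congˡ (-‿cong (+-identityˡ S)) ⟩
      ⟨ u , z ⟩ - S                   ≈⟨ pairing-residual d (p ∘ suc) u z ⟨
      ⟨ residual d (p ∘ suc) u , z ⟩  ∎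
      where S = sum (λ l → ⟨ d l , u ⟩ * ⟨ p (suc l) , z ⟩)
    orthogonal : ∀ u j → ⟨ residual d⁺ p u , p j ⟩ ≈ 0#
    orthogonal u zero    = trans (same u _) (trans (⟨⟩-congʳ _ (x-y≈0⇒x≈y (definite r₀ N≈0)))
      (orthogonal-combination _ (p ∘ suc) (d-dual u)))
    orthogonal u (suc j) = trans (same u _) (d-dual u j)
  ...   | no N≉0 = d⁺ , orthogonal
    where
    p′ = p ∘ suc
    r₀ = residual d p′ (p zero)
    N  = ⟨ r₀ , r₀ ⟩
    -- A Gram-Schmidt step: `⟨ e , u ⟩` is the coefficient of `r₀` in the new projection. Writing
    -- `r₀` as `p zero` minus its own projection gives the correction of the remaining coefficients
    -- in `d⁺`.
    e  = N ⁻¹ *ₗ r₀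
    d⁺ : Fin (suc n) → Carrierᴹ
    d⁺ zero    = e
    d⁺ (suc l) = d l -ᴹ ⟨ d l , p zero ⟩ *ₗ e
    pairing-d⁺ : ∀ u l → ⟨ d⁺ (suc l) , u ⟩ ≈ ⟨ d l , u ⟩ - ⟨ d l , p zero ⟩ * ⟨ e , u ⟩
    pairing-d⁺ u l = trans (⟨⟩-minusˡ _ _ u) (+-congˡ (-‿cong (⟨⟩-homogeneousˡ _ e u)))
    expand : ∀ u z → ⟨ residual d⁺ p u , z ⟩ ≈ ⟨ residual d p′ u , z ⟩ - ⟨ e , u ⟩ * ⟨ r₀ , z ⟩
    expand u z = begin
      ⟨ residual d⁺ p u , z ⟩         ≈⟨ pairing-residual d⁺ p u z ⟩
      ⟨ u , z ⟩ - (⟨ e , u ⟩ * ⟨ p zero , z ⟩ + sum (λ l → ⟨ d⁺ (suc l) , u ⟩ * ⟨ p′ l , z ⟩))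
        ≈⟨ +-congˡ (-‿cong (+-congˡ (trans (sum-cong {n} λ l → *-congʳ (pairing-d⁺ u l))
             (sum-minus-multiple (λ l → ⟨ d l , u ⟩) (λ l → ⟨ d l , p zero ⟩) (λ l → ⟨ p′ l , z ⟩) ⟨ e , u ⟩)))) ⟩
      ⟨ u , z ⟩ - (⟨ e , u ⟩ * ⟨ p zero , z ⟩ + (A - ⟨ e , u ⟩ * B))
        ≈⟨ solve 5 (λ u e p A B → u :- (e :* p :+ (A :- e :* B)) := (u :- A) :- e :* (p :- B)) refl _ _ _ _ _ ⟩
      (⟨ u , z ⟩ - A) - ⟨ e , u ⟩ * (⟨ p zero , z ⟩ - B)
        ≈⟨ +-cong (pairing-residual d p′ u z) (-‿cong (*-congˡ (pairing-residual d p′ (p zero) z))) ⟨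
      ⟨ residual d p′ u , z ⟩ - ⟨ e , u ⟩ * ⟨ r₀ , z ⟩   ∎
      where
      A = sum (λ l → ⟨ d l , u ⟩ * ⟨ p′ l , z ⟩)
      B = sum (λ l → ⟨ d l , p zero ⟩ * ⟨ p′ l , z ⟩)
    orthogonal-suc : ∀ u j → ⟨ residual d⁺ p u , p′ j ⟩ ≈ 0#
    orthogonal-suc u j =
      trans (expand u _) (trans
        (+-cong (d-dual u j) (-‿cong (trans (*-congˡ (d-dual (p zero) j)) (zeroʳ _)))) (-‿inverseʳ 0#))
    p₀≈ : p zero ≈ᴹ r₀ +ᴹ combination (λ l → ⟨ d l , p zero ⟩) p′
    p₀≈ = linear (↑ p zero) (((↑ p zero) ⊝ (↑ c)) ⊕ (↑ c)) λ z → solve 2 (λ x y → x := (x :- y) :+ y) refl _ _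
      where c = combination (λ l → ⟨ d l , p zero ⟩) p′
    to-r₀ : ∀ u → ⟨ residual d⁺ p u , r₀ ⟩ ≈ 0#
    to-r₀ u = begin
      ⟨ residual d⁺ p u , r₀ ⟩                   ≈⟨ expand u r₀ ⟩
      ⟨ residual d p′ u , r₀ ⟩ - ⟨ e , u ⟩ * N
        ≈⟨ +-cong (trans (⟨⟩-minusˡ _ _ r₀) (+-congˡ (-‿cong (trans (⟨⟩-symmetric _ r₀)
             (orthogonal-combination _ p′ (d-dual (p zero)))))))
                                                      (-‿cong (*-congʳ (⟨⟩-homogeneousˡ (N ⁻¹) r₀ u))) ⟩
      (⟨ u , r₀ ⟩ - 0#) - (N ⁻¹ * ⟨ r₀ , u ⟩) * N   ≈⟨ +-congʳ (+-congʳ (⟨⟩-symmetric u r₀)) ⟩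
      (⟨ r₀ , u ⟩ - 0#) - (N ⁻¹ * ⟨ r₀ , u ⟩) * N
        ≈⟨ solve 3 (λ x i n → (x :- con ℤ.0ℤ) :- (i :* x) :* n := x :- (i :* n) :* x) refl _ _ _ ⟩
      ⟨ r₀ , u ⟩ - (N ⁻¹ * N) * ⟨ r₀ , u ⟩
        ≈⟨ +-congˡ (-‿cong (trans (*-congʳ (⁻¹-inverseˡ N≉0)) (*-identityˡ _))) ⟩
      ⟨ r₀ , u ⟩ - ⟨ r₀ , u ⟩                    ≈⟨ -‿inverseʳ _ ⟩
      0#                                         ∎
    orthogonal : ∀ u j → ⟨ residual d⁺ p u , p j ⟩ ≈ 0#
    orthogonal u (suc j) = orthogonal-suc u j
    orthogonal u zero    = trans (⟨⟩-congʳ _ p₀≈) (trans (⟨⟩-additiveʳ _ r₀ _)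
      (trans (+-cong (to-r₀ u) (orthogonal-combination _ p′ (orthogonal-suc u))) (+-identityˡ 0#)))

  -- The residual is orthogonal to the span of `p`; for `u` in this span it also lies in it, hence
  -- is orthogonal to itself.
  dual-reproduces : ∀ {n} {d p : Fin n → Carrierᴹ} →
    (∀ u j → ⟨ residual d p u , p j ⟩ ≈ 0#) →
    ∀ {u} b → u ≈ᴹ combination b p → u ≈ᴹ combination (λ l → ⟨ d l , u ⟩) p
  dual-reproduces {d = d} {p} d-dual {u} b u≈ = x-y≈0⇒x≈y (definite r (begin
    ⟨ r , r ⟩                               ≈⟨ ⟨⟩-minusʳ r u _ ⟩
    ⟨ r , u ⟩ - ⟨ r , combination _ p ⟩     ≈⟨ +-cong (trans (⟨⟩-congʳ r u≈) (orthogonal-combination b p (d-dual u)))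
                                                (-‿cong (orthogonal-combination _ p (d-dual u))) ⟩
    0# - 0#                                 ≈⟨ -‿inverseʳ 0# ⟩
    0#                                      ∎))
    where r = residual d p u

  -- Greedy selection: a basis for the later generators is enlarged by `g zero` exactly when `J`
  -- contains its index and its residual has nonzero length.
  independent-subfamily : ∀ {n} (g : Fin n → Carrierᴹ) {J : Pred (Fin n) 0ℓ} → (∀ j → Dec (J j)) →
    ∃ λ m → Σ (Fin m → Carrierᴹ) λ p → LinearlyIndependent p ×
      (∀ l → ∃ λ j → J j × p l ≈ᴹ g j) ×
      (∀ {j} → J j → Σ (Fin m → Carrier) λ c → g j ≈ᴹ combination c p)
  independent-subfamily {zero}  g J? = zero , (λ ()) , (λ _ _ ()) , (λ ()) , λ { {()} }
  independent-subfamily {suc n} g {J} J?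
    with independent-subfamily (g ∘ suc) (J? ∘ suc) | J? zero
  ... | m , p , indep , p∈ , g∈ | no 0∉J =
    m , p , indep , (λ l → let j , j∈J , eq = p∈ l in suc j , j∈J , eq) ,
    λ { {zero} 0∈J → ⊥-elim (0∉J 0∈J) ; {suc j} j∈J → g∈ j∈J }
  ... | m , p , indep , p∈ , g∈ | yes 0∈J with dual-family p
  ...   | d , d-dual with ⟨ residual d p (g zero) , residual d p (g zero) ⟩ ≟ 0#
  ...     | yes N≈0 =
    m , p , indep , (λ l → let j , j∈J , eq = p∈ l in suc j , j∈J , eq) ,
    λ { {zero} _ → _ , x-y≈0⇒x≈y (definite _ N≈0) ; {suc j} j∈J → g∈ j∈J }
  ...     | no N≉0 = suc m , p⁺ , indep⁺ , p⁺∈ , g⁺∈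
    where
    r = residual d p (g zero)
    N = ⟨ r , r ⟩
    p⁺ : Fin (suc m) → Carrierᴹ
    p⁺ zero    = g zero
    p⁺ (suc l) = p l
    p⁺∈ : ∀ l → ∃ λ j → J j × p⁺ l ≈ᴹ g j
    p⁺∈ zero    = zero , 0∈J , ≈ᴹ-refl
    p⁺∈ (suc l) = let j , j∈J , eq = p∈ l in suc j , j∈J , eq
    g⁺∈ : ∀ {j} → J j → Σ (Fin (suc m) → Carrier) λ c → g j ≈ᴹ combination c p⁺
    g⁺∈ {zero}  _   = δ zero , ≈ᴹ-sym (combination-δ zero p⁺)
    g⁺∈ {suc j} j∈J = let c , eq = g∈ j∈J in (λ { zero → 0# ; (suc l) → c l }) ,
      ≈ᴹ-trans eq (≈ᴹ-trans (≈ᴹ-sym (+ᴹ-identityˡ _)) (+ᴹ-congʳ (≈ᴹ-sym (*ₗ-zeroˡ (g zero)))))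
    r⊥p : ∀ c → ⟨ r , combination c p ⟩ ≈ 0#
    r⊥p c = orthogonal-combination c p (d-dual (g zero))
    ⟨r,g₀⟩≈N : ⟨ r , g zero ⟩ ≈ N
    ⟨r,g₀⟩≈N = sym (trans (⟨⟩-minusʳ r (g zero) _) (trans (+-congˡ (-‿cong (r⊥p _)))
      (solve 1 (λ x → x :- con ℤ.0ℤ := x) refl _)))
    indep⁺ : LinearlyIndependent p⁺
    indep⁺ c c·p⁺≈0 = λ { zero → c₀≈0 ; (suc l) → indep (c ∘ suc) c·p≈0 l }
      where
      c₀≈0 : c zero ≈ 0#
      -- Pairing the relation with `r` kills every term except that of `g zero`.
      c₀≈0 = *-cancel-nonZero N≉0 (begin
        N * c zero                                      ≈⟨ *-congʳ ⟨r,g₀⟩≈N ⟨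
        ⟨ r , g zero ⟩ * c zero                         ≈⟨ *-comm _ _ ⟩
        c zero * ⟨ r , g zero ⟩                         ≈⟨ +-identityʳ _ ⟨
        c zero * ⟨ r , g zero ⟩ + 0#
          ≈⟨ +-cong (⟨⟩-homogeneousʳ (c zero) r (g zero)) (r⊥p (c ∘ suc)) ⟨
        ⟨ r , c zero *ₗ g zero ⟩ + ⟨ r , combination (c ∘ suc) p ⟩   ≈⟨ ⟨⟩-additiveʳ r _ _ ⟨
        ⟨ r , combination c p⁺ ⟩                        ≈⟨ ⟨⟩-congʳ r c·p⁺≈0 ⟩
        ⟨ r , 0ᴹ ⟩                                      ≈⟨ trans (⟨⟩-symmetric r 0ᴹ) (⟨⟩-zeroˡ r) ⟩
        0#                                              ∎)
      c·p≈0 : combination (c ∘ suc) p ≈ᴹ 0ᴹ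
      c·p≈0 = ≈ᴹ-trans (≈ᴹ-sym (+ᴹ-identityˡ _)) (≈ᴹ-trans
        (+ᴹ-congʳ (≈ᴹ-sym (≈ᴹ-trans (*ₗ-congʳ c₀≈0) (*ₗ-zeroˡ (g zero))))) c·p⁺≈0)

-- Relative interior through strictly positive weights.

module RelativeInterior {ℝ : Reals} (E : EuclideanSpace ℝ)
  (definite : InnerProduct.IsDefinite E) where
  open Convexity E definite public

  StrictWeights : ∀ {n} → (Fin n → Carrierᴹ) → Pred (Fin n) 0ℓ → Carrier → Carrierᴹ → Set
  StrictWeights {n} g J t x = Σ (Fin n → Carrier) λ a →
    (∀ j → ¬ J j → a j ≈ 0#) × (∀ j → J j → 0# < a j) × sum a ≈ t × x ≈ᴹ combination a g

  strict⇒convex : ∀ {n} {g : Fin n → Carrierᴹ} {J : Pred (Fin n) 0ℓ} → (∀ j → Dec (J j)) →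
    ∀ {t x} → StrictWeights g J t x → Family.Comb g convex J t x
  strict⇒convex {g = g} {J} J? (a , off , pos , sum≈ , x≈) = Family.comb a off (λ j → 0≤a j (J? j)) sum≈ x≈
    where
    0≤a : ∀ j → Dec (J j) → 0# ≤ a j
    0≤a j (yes j∈J) = proj₁ (pos j j∈J)
    0≤a j (no  j∉J) = ≤-reflexive (sym (off j j∉J))

  normalise : ∀ {n} {g : Fin n → Carrierᴹ} {J : Pred (Fin n) 0ℓ} {t x} → 0# < t →
    StrictWeights g J t x → StrictWeights g J 1# (t ⁻¹ *ₗ x)
  normalise {g = g} {t = t} 0<t (a , off , pos , sum≈ , x≈) =
    (λ j → t ⁻¹ * a j) ,
    (λ j j∉J → trans (*-congˡ (off j j∉J)) (zeroʳ _)) ,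
    (λ j j∈J → *-positive (⁻¹-positive 0<t) (pos j j∈J)) ,
    trans (sym (*-distribˡ-sum (t ⁻¹) a)) (trans (*-congˡ sum≈) (⁻¹-inverseˡ (positive⇒nonZero 0<t))) ,
    ≈ᴹ-trans (*ₗ-congˡ x≈) (≈ᴹ-sym (combination-* (t ⁻¹) a g))

  total-positive : ∀ {n} {g : Fin n → Carrierᴹ} {J : Pred (Fin n) 0ℓ} → (∀ j → Dec (J j)) →
    ∀ {t x j} → J j → StrictWeights g J t x → 0# < t
  total-positive {g = g} J? {j = j} j∈J sx@(a , off , pos , sum≈ , x≈) =
    0<-resp sum≈ (0<x≤y⇒0<y (pos j j∈J) (term≤sum (Family.admissible (strict⇒convex {g = g} J? sx)) j))

  step-norm : ∀ s x p → ⟨ (x +ᴹ s *ₗ (x -ᴹ p)) -ᴹ x , (x +ᴹ s *ₗ (x -ᴹ p)) -ᴹ x ⟩ ≈ (s * s) * ⟨ x -ᴹ p , x -ᴹ p ⟩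
  step-norm s x p = begin
    ⟨ y , y ⟩                ≈⟨ ⟨⟩-cong y≈ y≈ ⟩
    ⟨ s *ₗ q , s *ₗ q ⟩      ≈⟨ ⟨⟩-homogeneousˡ s q _ ⟩
    s * ⟨ q , s *ₗ q ⟩       ≈⟨ *-congˡ (⟨⟩-homogeneousʳ s q q) ⟩
    s * (s * ⟨ q , q ⟩)      ≈⟨ *-assoc s s _ ⟨
    (s * s) * ⟨ q , q ⟩      ∎
    where
    q = x -ᴹ p
    y = (x +ᴹ s *ₗ (x -ᴹ p)) -ᴹ x
    y≈ : y ≈ᴹ s *ₗ q
    y≈ = linear ((↑ x ⊕ s ⊙ ↑ q) ⊝ ↑ x) (s ⊙ ↑ q) λ z →
      solve 3 (λ x s q → (x :+ s :* q) :- x := s :* q) refl _ _ _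

  -- The choice s = ε / (1 + N) avoids a square root of N: the gap ε² - s² N equals s² ((1 + N)² -
  -- N) = s² (1 + N + N²), which is positive.
  short-step : ∀ {ε N} → 0# < ε → 0# ≤ N →
    ∃ λ s → 0# < s × (s * s) * N < ε * ε
  short-step {ε} {N} 0<ε 0≤N = ε * i , 0<εi , proj₁ strict , proj₂ strict
    where
    0<1+N : 0# < 1# + N
    0<1+N = +-positive 0<1 0≤N
    i = (1# + N) ⁻¹
    0<εi : 0# < ε * i
    0<εi = *-positive 0<ε (⁻¹-positive 0<1+N)
    s² = (ε * i) * (ε * i)
    0<gap : 0# < s² * (1# + (N + N * N))
    0<gap = *-positive (*-positive 0<εi 0<εi) (+-positive 0<1 (+-nonNegative 0≤N (square-nonNegative N)))
    gap : s² * (1# + (N + N * N)) ≈ ε * ε - s² * N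
    gap = begin
      s² * (1# + (N + N * N))
        ≈⟨ solve 3 (λ e i n → ((e :* i) :* (e :* i)) :* (con ℤ.1ℤ :+ (n :+ n :* n))
             := (e :* e) :* ((i :* (con ℤ.1ℤ :+ n)) :* (i :* (con ℤ.1ℤ :+ n))) :- ((e :* i) :* (e :* i)) :* n) refl ε i N ⟩
      (ε * ε) * ((i * (1# + N)) * (i * (1# + N))) - s² * N
        ≈⟨ +-congʳ (*-congˡ (*-cong inv inv)) ⟩
      (ε * ε) * (1# * 1#) - s² * N
        ≈⟨ +-congʳ (trans (*-congˡ (*-identityˡ 1#)) (*-identityʳ _)) ⟩
      ε * ε - s² * N ∎
      where
      inv : i * (1# + N) ≈ 1#
      inv = ⁻¹-inverseˡ (positive⇒nonZero 0<1+N)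
    strict : s² * N < ε * ε
    strict = ≤-by-difference (proj₁ 0<gap) gap ,
      λ eq → proj₂ 0<gap (sym (trans gap (trans (+-congˡ (-‿cong eq)) (-‿inverseʳ _))))

  -- From 0 ≤ ⟨ u + ε D , u + ε D ⟩, which avoids the Cauchy-Schwarz inequality
  -- and square roots.
  functional-bound : ∀ D {η} → 0# < η →
    ∃ λ ε → 0# < ε × (∀ u → ⟨ u , u ⟩ ≤ ε * ε → 0# ≤ η + ⟨ D , u ⟩)
  functional-bound D {η} 0<η = ε , 0<ε , bound
    where
    M = ⟨ D , D ⟩
    0<1+M : 0# < 1# + M
    0<1+M = +-positive 0<1 (⟨x,x⟩≥0 D)
    i = (1# + M) ⁻¹
    -- Chosen so that ε² (1 + M) = ε η. Then ⟨ w , w ⟩ + (ε² - U) + ε η, a sum of nonnegative terms,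
    -- equals 2 ε (η + t).
    ε = η * i
    0<ε : 0# < ε
    0<ε = *-positive 0<η (⁻¹-positive 0<1+M)
    ε[1+M]≈η : ε * (1# + M) ≈ η
    ε[1+M]≈η = trans (*-assoc η i _) (trans (*-congˡ (⁻¹-inverseˡ (positive⇒nonZero 0<1+M))) (*-identityʳ η))
    bound : ∀ u → ⟨ u , u ⟩ ≤ ε * ε → 0# ≤ η + ⟨ D , u ⟩
    bound u U≤ε² = *-cancelˡ-≤ {z = 2# * ε} (*-positive 0<2 0<ε) (≤-respˡ-≈ (sym (zeroʳ _)) (0≤-resp total-eq
        (+-nonNegative (+-nonNegative (⟨x,x⟩≥0 w) (x≤y⇒0≤y-x U≤ε²)) (*-nonNegative (proj₁ 0<ε) (proj₁ 0<η)))))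
      where
      w = u +ᴹ ε *ₗ D
      t = ⟨ D , u ⟩
      U = ⟨ u , u ⟩
      norm : ⟨ w , w ⟩ ≈ (U + ε * t) + ε * (t + ε * M)
      norm = trans (⟨⟩-additiveˡ u _ w) (+-cong
        (trans (⟨⟩-additiveʳ u u _) (+-congˡ (trans (⟨⟩-homogeneousʳ ε u D) (*-congˡ (⟨⟩-symmetric u D)))))
        (trans (⟨⟩-homogeneousˡ ε D w) (*-congˡ (trans (⟨⟩-additiveʳ D u _) (+-congˡ (⟨⟩-homogeneousʳ ε D D))))))
      total-eq : ⟨ w , w ⟩ + (ε * ε - U) + ε * η ≈ (2# * ε) * (η + t)
      total-eq = begin
        ⟨ w , w ⟩ + (ε * ε - U) + ε * η
          ≈⟨ +-congʳ (+-congʳ norm) ⟩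
        (U + ε * t) + ε * (t + ε * M) + (ε * ε - U) + ε * η
          ≈⟨ solve 5 (λ U e t M h → (U :+ e :* t) :+ e :* (t :+ e :* M) :+ (e :* e :- U) :+ e :* h
               := (con ℤ.1ℤ :+ con ℤ.1ℤ) :* e :* t :+ e :* (e :* (con ℤ.1ℤ :+ M)) :+ e :* h) refl U ε t M η ⟩
        2# * ε * t + ε * (ε * (1# + M)) + ε * η
          ≈⟨ +-congʳ (+-congˡ (*-congˡ ε[1+M]≈η)) ⟩
        2# * ε * t + ε * η + ε * η
          ≈⟨ solve 3 (λ e t h → (con ℤ.1ℤ :+ con ℤ.1ℤ) :* e :* t :+ e :* h :+ e :* h
               := ((con ℤ.1ℤ :+ con ℤ.1ℤ) :* e) :* (h :+ t)) refl ε t η ⟩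
        (2# * ε) * (η + t) ∎

  square-mono : ∀ {x y} → 0# < x → x ≤ y → x * x ≤ y * y
  square-mono {x} {y} 0<x x≤y = ≤-trans (*-monoˡ-≤ (proj₁ 0<x) x≤y)
    (≤-respˡ-≈ (*-comm y x) (*-monoˡ-≤ (≤-trans (proj₁ 0<x) x≤y) x≤y))

  -- A face enters only through the index set `J` of its generators, so that the same lemmas serve
  -- the faces of the whole polytope and those of its components.
  module _ {n} (g : Fin n → Carrierᴹ) {J : Pred (Fin n) 0ℓ} (J? : ∀ j → Dec (J j)) {F : Subset}
    (F⊆ : ∀ {x} → x ∈ F → Family.Comb g convex J 1# x)
    (F⊇ : ∀ {x} → Family.Comb g convex J 1# x → x ∈ F) where
    open Family g

    affineHull⊆ : ∀ {x} → x ∈ affineHull F → Comb affine J 1# x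
    affineHull⊆ = hull⊆Comb (λ y∈F → Comb-affine {J = J} (F⊆ y∈F))

    affineHull⊇ : ∀ {x} → Comb affine J 1# x → x ∈ affineHull F
    affineHull⊇ = Comb⊆hull J? {F} λ j∈J → F⊇ (Comb-generator j∈J)

    -- A short step from `x` away from `g j` leads to a point `y` still in `F`, and (2 + s) x = x +
    -- y + s (g j). The last term makes the weight at `j` positive, and the first keeps the old
    -- positive weights positive.
    make-positive : ∀ {x} → x ∈ relativeInterior F → ∀ {j} → J j → (cx : Comb convex J 1# x) →
      Σ (Comb convex J 1# x) λ cx′ → 0# < weights cx′ j × (∀ l → 0# < weights cx l → 0# < weights cx′ l)
    make-positive {x} (x∈F , ε , 0<ε , ball) {j} j∈J cx = mix (short-step 0<ε (⟨x,x⟩≥0 (x -ᴹ g j)))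
      where
      mix : (∃ λ s → 0# < s × (s * s) * ⟨ x -ᴹ g j , x -ᴹ g j ⟩ < ε * ε) →
        Σ (Comb convex J 1# x) λ cx′ → 0# < weights cx′ j × (∀ l → 0# < weights cx l → 0# < weights cx′ l)
      mix (s , 0<s , s²N<ε²) = Comb-resp weight≈1 point≈x mixed , positive-new , positive-old
        where
        p = g j
        y = x +ᴹ s *ₗ (x -ᴹ p)
        cy : Comb convex J 1# y
        cy = F⊆ (ball y
          (affineHull⊇ (Comb-resp (solve 1 (λ s → (con ℤ.1ℤ :+ s) :* con ℤ.1ℤ :+ (:- s) :* con ℤ.1ℤ := con ℤ.1ℤ) refl s)
            (linear ((1# + s) ⊙ ↑ x ⊕ (- s) ⊙ ↑ p) (↑ x ⊕ s ⊙ (↑ x ⊝ ↑ p)) λ z →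
              solve 3 (λ s x p → (con ℤ.1ℤ :+ s) :* x :+ (:- s) :* p := x :+ s :* (x :- p)) refl s _ _)
            (Comb-+ (Comb-* tt (Comb-affine {J = J} cx)) (Comb-* tt (Comb-generator {κ = affine} j∈J)))))
          (≤-respˡ-≈ (sym (step-norm s x p)) (proj₁ s²N<ε²) , proj₂ s²N<ε² ∘ trans (sym (step-norm s x p))))
        0<2+s : 0# < 2# + s
        0<2+s = +-positive 0<2 (proj₁ 0<s)
        σ = (2# + s) ⁻¹
        0<σ : 0# < σ
        0<σ = ⁻¹-positive 0<2+s
        mixed = Comb-* {κ = convex} (proj₁ 0<σ)
          (Comb-+ (Comb-+ cx cy) (Comb-* {κ = convex} (proj₁ 0<s) (Comb-generator {κ = convex} j∈J)))
        σ[2+s]≈1 : σ * (2# + s) ≈ 1#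
        σ[2+s]≈1 = ⁻¹-inverseˡ (positive⇒nonZero 0<2+s)
        weight≈1 : σ * ((1# + 1#) + s * 1#) ≈ 1#
        weight≈1 = trans (*-congˡ (+-congˡ (*-identityʳ s))) σ[2+s]≈1
        point≈x : σ *ₗ ((x +ᴹ y) +ᴹ s *ₗ p) ≈ᴹ x
        point≈x = linear (σ ⊙ ((↑ x ⊕ (↑ x ⊕ s ⊙ (↑ x ⊝ ↑ p))) ⊕ s ⊙ ↑ p)) (↑ x) λ z →
          trans (solve 4 (λ c x s p → c :* ((x :+ (x :+ s :* (x :- p))) :+ s :* p)
                   := (c :* ((con ℤ.1ℤ :+ con ℤ.1ℤ) :+ s)) :* x) refl σ _ s _)
                (trans (*-congʳ σ[2+s]≈1) (*-identityˡ _))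
        a = weights cx
        b = weights cy
        0≤a = admissible cx
        0≤b = admissible cy
        0≤sδ : ∀ l → 0# ≤ s * δ j l
        0≤sδ l = *-nonNegative (proj₁ 0<s) (δ-nonNegative j l)
        positive-new : 0# < σ * ((a j + b j) + s * δ j j)
        positive-new = *-positive 0<σ (0<-resp (+-comm _ _)
          (+-positive (*-positive 0<s (0<-resp (sym (δ-diagonal j)) 0<1)) (+-nonNegative (0≤a j) (0≤b j))))
        positive-old : ∀ l → 0# < a l → 0# < σ * ((a l + b l) + s * δ j l)
        positive-old l 0<al = *-positive 0<σ (+-positive (+-positive 0<al (0≤b l)) (0≤sδ l))

    -- Induction along a list `f` of indices leaves the family `g` fixed while weights become
    -- positive one by one; `f = id` reaches all of them.
    interior⇒somePositive : ∀ {x} → x ∈ relativeInterior F → ∀ {m} (f : Fin m → Fin n) →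
      Σ (Comb convex J 1# x) λ cx → ∀ l → J (f l) → 0# < weights cx (f l)
    interior⇒somePositive {x} x∈int {zero}  f = F⊆ (proj₁ x∈int) , λ ()
    interior⇒somePositive {x} x∈int {suc m} f = extend (interior⇒somePositive x∈int (f ∘ suc)) (J? (f zero))
      where
      extend : (Σ (Comb convex J 1# x) λ cx → ∀ l → J (f (suc l)) → 0# < weights cx (f (suc l))) → Dec (J (f zero)) →
               Σ (Comb convex J 1# x) λ cx → ∀ l → J (f l) → 0# < weights cx (f l)
      extend (cx , pos) (no  f₀∉J) = cx , λ { zero f₀∈J → ⊥-elim (f₀∉J f₀∈J) ; (suc l) → pos l }
      extend (cx , pos) (yes f₀∈J) = let cx′ , new , old = make-positive x∈int f₀∈J cx in
        cx′ , λ { zero _ → new ; (suc l) fl∈J → old _ (pos l fl∈J) }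

    interior⇒strict : ∀ {x} → x ∈ relativeInterior F → StrictWeights g J 1# x
    interior⇒strict x∈int with interior⇒somePositive x∈int id
    ... | comb a off _ sum≈ x≈ , pos = a , off , pos , sum≈ , x≈

    -- D gives affine coordinates on the affine hull: they depend on u linearly
    -- and sum to zero on its direction space.
    affine-dual : ∀ {j₀} → J j₀ → Σ (Fin n → Carrierᴹ) λ D →
      (∀ j u → ¬ J j → ⟨ D j , u ⟩ ≈ 0#) × (∀ u → sum (λ j → ⟨ D j , u ⟩) ≈ 0#) ×
      (∀ {u} → Comb affine J 0# u → u ≈ᴹ combination (λ j → ⟨ D j , u ⟩) g)
    affine-dual {j₀} j₀∈J = D , off , sum≈0 , reproduces
      where
      m : Fin n → Carrier
      m j = restrict (J? j) 1#
      -- Differences to the base point `g j₀` span the direction space; the mask `m` removes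
      -- generators off `J`.
      h : Fin n → Carrierᴹ
      h j = m j *ₗ (g j -ᴹ g j₀)
      d = proj₁ (dual-family h)
      S = combination m d
      D : Fin n → Carrierᴹ
      -- The coefficients of the differences `h j` are kept on the `g j`, and their total `S` is
      -- subtracted at the base point, which makes the coordinates sum to zero.
      D j = m j *ₗ d j -ᴹ δ j₀ j *ₗ S
      pairing-D : ∀ j u → ⟨ D j , u ⟩ ≈ m j * ⟨ d j , u ⟩ - δ j₀ j * ⟨ S , u ⟩
      pairing-D j u = pairing-correct (m j ⊙ ↑ d j ⊝ δ j₀ j ⊙ ↑ S) u
      off : ∀ j u → ¬ J j → ⟨ D j , u ⟩ ≈ 0#
      off j u j∉J = trans (pairing-D j u) (trans (+-cong
        (trans (*-congʳ (restrict-no (J? j) j∉J)) (zeroˡ _))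
        (-‿cong (trans (*-congʳ (δ-offDiagonal {i = j₀} {j} λ { ≡.refl → j∉J j₀∈J })) (zeroˡ _)))) (-‿inverseʳ 0#))
      weighted-sum : ∀ u (w : Fin n → Carrier) → sum (λ j → ⟨ D j , u ⟩ * w j) ≈
        sum (λ j → (m j * ⟨ d j , u ⟩) * w j) - ⟨ S , u ⟩ * w j₀
      weighted-sum u w = begin
        sum (λ j → ⟨ D j , u ⟩ * w j)
          ≈⟨ sum-cong {n} (λ j → *-congʳ (pairing-D j u)) ⟩
        sum (λ j → (m j * ⟨ d j , u ⟩ - δ j₀ j * ⟨ S , u ⟩) * w j)
          ≈⟨ sum-minus-multiple (λ j → m j * ⟨ d j , u ⟩) (δ j₀) w ⟨ S , u ⟩ ⟩
        sum (λ j → (m j * ⟨ d j , u ⟩) * w j) - ⟨ S , u ⟩ * sum (λ j → δ j₀ j * w j)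
          ≈⟨ +-congˡ (-‿cong (*-congˡ (sum-δ j₀ w))) ⟩
        sum (λ j → (m j * ⟨ d j , u ⟩) * w j) - ⟨ S , u ⟩ * w j₀ ∎
      sum≈0 : ∀ u → sum (λ j → ⟨ D j , u ⟩) ≈ 0#
      sum≈0 u = begin
        sum (λ j → ⟨ D j , u ⟩)                                       ≈⟨ sum-cong {n} (λ j → *-identityʳ _) ⟨
        sum (λ j → ⟨ D j , u ⟩ * 1#)                                  ≈⟨ weighted-sum u (λ _ → 1#) ⟩
        sum (λ j → (m j * ⟨ d j , u ⟩) * 1#) - ⟨ S , u ⟩ * 1#
          ≈⟨ +-cong (trans (sum-cong {n} λ j → *-identityʳ _) (sym (⟨⟩-combinationˡ m d u))) (-‿cong (*-identityʳ _)) ⟩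
        ⟨ S , u ⟩ - ⟨ S , u ⟩                                         ≈⟨ -‿inverseʳ _ ⟩
        0#                                                            ∎
      reproduces : ∀ {u} → Comb affine J 0# u → u ≈ᴹ combination (λ j → ⟨ D j , u ⟩) g
      reproduces {u} (comb b b-off _ sum-b u≈) = ≈ᴹ-trans
        (dual-reproduces (proj₂ (dual-family h)) b (≈ᴹ-trans u≈ shifted)) (ext λ z → begin
          ⟨ combination (λ j → ⟨ d j , u ⟩) h , z ⟩
            ≈⟨ ⟨⟩-combinationˡ _ h z ⟩
          sum (λ j → ⟨ d j , u ⟩ * ⟨ h j , z ⟩)
            ≈⟨ sum-cong {n} (λ j → trans (*-congˡ (pairing-h j z))
                 (solve 4 (λ m d x y → d :* (m :* (x :- y)) := (m :* d) :* x :- y :* (m :* d)) refl (m j) _ _ _)) ⟩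
          sum (λ j → (m j * ⟨ d j , u ⟩) * ⟨ g j , z ⟩ - ⟨ g j₀ , z ⟩ * (m j * ⟨ d j , u ⟩))
            ≈⟨ sum-- (λ j → (m j * ⟨ d j , u ⟩) * ⟨ g j , z ⟩) (λ j → ⟨ g j₀ , z ⟩ * (m j * ⟨ d j , u ⟩)) ⟩
          sum (λ j → (m j * ⟨ d j , u ⟩) * ⟨ g j , z ⟩) - sum (λ j → ⟨ g j₀ , z ⟩ * (m j * ⟨ d j , u ⟩))
            ≈⟨ +-congˡ (-‿cong (trans (sym (*-distribˡ-sum ⟨ g j₀ , z ⟩ (λ j → m j * ⟨ d j , u ⟩)))
                 (trans (*-comm _ _) (*-congʳ (sym (⟨⟩-combinationˡ m d u)))))) ⟩
          sum (λ j → (m j * ⟨ d j , u ⟩) * ⟨ g j , z ⟩) - ⟨ S , u ⟩ * ⟨ g j₀ , z ⟩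
            ≈⟨ weighted-sum u (λ j → ⟨ g j , z ⟩) ⟨
          sum (λ j → ⟨ D j , u ⟩ * ⟨ g j , z ⟩)
            ≈⟨ ⟨⟩-combinationˡ _ g z ⟨
          ⟨ combination (λ j → ⟨ D j , u ⟩) g , z ⟩ ∎)
        where
        pairing-h : ∀ j z → ⟨ h j , z ⟩ ≈ m j * (⟨ g j , z ⟩ - ⟨ g j₀ , z ⟩)
        pairing-h j z = pairing-correct (m j ⊙ (↑ g j ⊝ ↑ g j₀)) z
        bm≈b : ∀ j → b j * m j ≈ b j
        bm≈b j with J? j
        ... | yes _   = *-identityʳ _
        ... | no  j∉J = trans (zeroʳ _) (sym (b-off j j∉J))
        -- As `b` has total zero, subtracting `g j₀` from every generator changes nothing.
        shifted : combination b g ≈ᴹ combination b h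
        shifted = ext λ z → begin
          ⟨ combination b g , z ⟩                   ≈⟨ ⟨⟩-combinationˡ b g z ⟩
          sum (λ j → b j * ⟨ g j , z ⟩)             ≈⟨ solve 2 (λ x y → x := x :- con ℤ.0ℤ :* y) refl _ ⟨ g j₀ , z ⟩ ⟩
          sum (λ j → b j * ⟨ g j , z ⟩) - 0# * ⟨ g j₀ , z ⟩
            ≈⟨ +-congˡ (-‿cong (trans (*-comm _ _) (*-congˡ (sym sum-b)))) ⟩
          sum (λ j → b j * ⟨ g j , z ⟩) - ⟨ g j₀ , z ⟩ * sum b   ≈⟨ +-congˡ (-‿cong (*-distribˡ-sum ⟨ g j₀ , z ⟩ b)) ⟩
          sum (λ j → b j * ⟨ g j , z ⟩) - sum (λ j → ⟨ g j₀ , z ⟩ * b j)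
            ≈⟨ sum-- (λ j → b j * ⟨ g j , z ⟩) (λ j → ⟨ g j₀ , z ⟩ * b j) ⟨
          sum (λ j → b j * ⟨ g j , z ⟩ - ⟨ g j₀ , z ⟩ * b j)
            ≈⟨ sum-cong {n} (λ j → trans (solve 3 (λ b x y → b :* x :- y :* b := b :* (x :- y)) refl _ _ _)
                 (trans (*-congʳ (sym (bm≈b j))) (trans (*-assoc _ _ _) (*-congˡ (sym (pairing-h j z)))))) ⟩
          sum (λ j → b j * ⟨ h j , z ⟩)             ≈⟨ ⟨⟩-combinationˡ b h z ⟨
          ⟨ combination b h , z ⟩                   ∎

    -- A displacement u within the affine hull changes the weight at `j` by ⟨ D j , u ⟩. This is
    -- small against the positive `a j` when u is short, and zero off `J`, so one radius keeps all
    -- weights nonnegative.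
    strict⇒interior : ∀ {x} → StrictWeights g J 1# x → x ∈ relativeInterior F
    strict⇒interior {x} sx@(a , a-off , pos , sum-a , x≈)
      = F⊇ cx , ball (affine-dual (proj₂ (support {κ = convex} J? cx)))
      where
      cx : Comb convex J 1# x
      cx = strict⇒convex J? sx
      ball : (Σ (Fin n → Carrierᴹ) λ D →
          (∀ j u → ¬ J j → ⟨ D j , u ⟩ ≈ 0#) × (∀ u → sum (λ j → ⟨ D j , u ⟩) ≈ 0#) ×
          (∀ {u} → Comb affine J 0# u → u ≈ᴹ combination (λ j → ⟨ D j , u ⟩) g)) →
        ∃ λ ε → 0# < ε × (∀ y → y ∈ affineHull F → ⟨ y -ᴹ x , y -ᴹ x ⟩ < ε * ε → y ∈ F)
      ball (D , D-off , D-sum , reproduces) = ε , 0<ε , λ y y∈aff y-near →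
        F⊇ (inside y (affineHull⊆ y∈aff) (proj₁ y-near))
        where
        Near : Fin n → Carrier → Set
        Near j ε = ∀ u → ⟨ u , u ⟩ ≤ ε * ε → 0# ≤ a j + ⟨ D j , u ⟩
        near : ∀ j → Dec (J j) → ∃ λ ε → 0# < ε × Near j ε
        near j (yes j∈J) = functional-bound (D j) (pos j j∈J)
        near j (no  j∉J) = 1# , 0<1 , λ u _ → ≤-reflexive (sym
              (trans (+-cong (a-off j j∉J) (D-off j u j∉J)) (+-identityˡ 0#)))
        radius = common-radius {P = Near}
          (λ j 0<ε ε≤ε′ h u U≤ε² → h u (≤-trans U≤ε² (square-mono 0<ε ε≤ε′))) (λ j → near j (J? j))
        ε = proj₁ radius
        0<ε = proj₁ (proj₂ radius)
        inside : ∀ y → Comb affine J 1# y → ⟨ y -ᴹ x , y -ᴹ x ⟩ ≤ ε * ε → Comb convex J 1# y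
        inside y cy U≤ε² = comb (λ j → a j + ⟨ D j , u ⟩)
          (λ j j∉J → trans (+-cong (a-off j j∉J) (D-off j u j∉J)) (+-identityˡ 0#))
          (λ j → proj₂ (proj₂ radius) j u U≤ε²)
          (trans (∑-distrib-+ a (λ j → ⟨ D j , u ⟩))
            (trans (+-cong sum-a (D-sum u)) (+-identityʳ 1#)))
          (≈ᴹ-trans (linear (↑ y) (↑ x ⊕ (↑ y ⊝ ↑ x)) λ z → solve 2 (λ x y → y := x :+ (y :- x)) refl _ _)
            (≈ᴹ-trans (+ᴹ-cong x≈ (reproduces cu)) (≈ᴹ-sym (combination-+ a _ g))))
          where
          u = y -ᴹ x
          cu : Comb affine J 0# u
          cu = Comb-resp (solve 0 (con ℤ.1ℤ :+ (:- con ℤ.1ℤ) :* con ℤ.1ℤ := con ℤ.0ℤ) refl)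
            (linear (↑ y ⊕ (- 1#) ⊙ ↑ x) (↑ y ⊝ ↑ x) λ z → solve 2 (λ x y → y :+ (:- con ℤ.1ℤ) :* x := y :- x) refl _ _)
            (Comb-+ cy (Comb-* tt (Comb-affine {J = J} cx)))

-- Coordinates in the simple roots.

module SimpleRootCoordinates {ℝ : Reals} (E : EuclideanSpace ℝ)
  (Φ : Geometry.RootSystem E) (Π : Geometry.SimpleRoots E Φ) where
  open InnerProduct E
  open RootSystem Φ
  open SimpleRoots Π

  Coordinates : Carrierᴹ → Set
  Coordinates x = Σ (Fin rank → Carrier) λ a → x ≈ᴹ combination a simple

  coordinates : ∀ x → Coordinates x
  coordinates x = proj₁ c·p , ≈ᴹ-trans x≈ (proj₂ c·p)
    where
    c = proj₁ (proj₂ (spanning x))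
    p = proj₁ (proj₂ (proj₂ (spanning x)))
    p∈Φ = proj₁ (proj₂ (proj₂ (proj₂ (spanning x))))
    x≈ = proj₂ (proj₂ (proj₂ (proj₂ (spanning x))))
    term : ∀ j → Coordinates (c j *ₗ p j)
    term j = let z , _ , eq = decompose (p∈Φ j) in
      _ , ≈ᴹ-trans (*ₗ-congˡ eq) (≈ᴹ-sym (combination-* (c j) (λ l → fromℤ (z l)) simple))
    c·p : Coordinates (combination c p)
    c·p = combination-closed (λ _ → Coordinates)
      ((λ _ → 0#) , ≈ᴹ-sym (combination-zero simple λ _ → refl))
      (λ (a , x≈) (b , y≈) → (λ j → a j + b j) , ≈ᴹ-trans (+ᴹ-cong x≈ y≈) (≈ᴹ-sym (combination-+ a b simple)))
      c p term

  -- Vanishing of a coordinate is decidable, while equality of vectors need not be. A nonzero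
  -- coordinate would make `x` nonzero by independence, against its zero length.
  definite : IsDefinite
  definite x N≈0 = ≈ᴹ-trans x≈ (combination-zero simple a≈0)
    where
    a = proj₁ (coordinates x)
    x≈ = proj₂ (coordinates x)
    a≈0 : ∀ j → a j ≈ 0#
    a≈0 j with a j ≟ 0#
    ... | yes aj≈0 = aj≈0
    ... | no  aj≉0 = ⊥-elim (proj₂ (positiveDefinite x λ x≈0 →
            aj≉0 (independent a (≈ᴹ-trans (≈ᴹ-sym x≈) x≈0) j)) (sym N≈0))

-- Faces of a centrally symmetric polytope.

module SymmetricPolytope {ℝ : Reals} (E : EuclideanSpace ℝ) (definite : InnerProduct.IsDefinite E)
  {n} (g : Fin n → EuclideanSpace.Carrierᴹ E) {J : Pred (Fin n) 0ℓ} (J? : ∀ j → Dec (J j))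
  {P : Geometry.Subset E}
  (P⊆ : ∀ {x} → x ∈ P → Definite.Family.Comb E definite g Definite.convex J (Reals.1# ℝ) x)
  (P⊇ : ∀ {x} → Definite.Family.Comb E definite g Definite.convex J (Reals.1# ℝ) x → x ∈ P) where
  open RelativeInterior E definite
  open Family g

  OnHyperplane : Carrierᴹ → Carrier → Pred (Fin n) 0ℓ
  OnHyperplane v c j = ⟨ v , g j ⟩ ≈ c

  weighted-pairing : ∀ v {κ J′ t x} (cx : Comb κ J′ t x) → ⟨ v , x ⟩ ≈ sum (λ j → weights cx j * ⟨ v , g j ⟩)
  weighted-pairing v (comb a _ _ _ x≈) = trans (⟨⟩-congʳ v x≈) (⟨⟩-combinationʳ a g v)

  hyperplane-pairing : ∀ {v c κ J′ t x} → (∀ {j} → J′ j → OnHyperplane v c j) → (∀ j → Dec (J′ j)) →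
    Comb κ J′ t x → ⟨ v , x ⟩ ≈ t * c
  hyperplane-pairing {v} {c} {t = t} {x} on J′? cx@(comb a off _ sum≈ _) = begin
    ⟨ v , x ⟩                        ≈⟨ weighted-pairing v cx ⟩
    sum (λ j → a j * ⟨ v , g j ⟩)    ≈⟨ sum-cong (λ j → same j (J′? j)) ⟩
    sum (λ j → a j * c)              ≈⟨ *-distribʳ-sum c a ⟨
    sum a * c                        ≈⟨ *-congʳ sum≈ ⟩
    t * c                            ∎
    where
    same : ∀ j → Dec _ → a j * ⟨ v , g j ⟩ ≈ a j * c
    same j (yes j∈J′) = *-congˡ (on j∈J′)
    same j (no  j∉J′) = trans (trans (*-congʳ (off j j∉J′)) (zeroˡ _)) (sym (trans (*-congʳ (off j j∉J′)) (zeroˡ c)))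

  on? : ∀ v c j → Dec (J j × OnHyperplane v c j)
  on? v c j = J? j ×-dec (⟨ v , g j ⟩ ≟ c)

  module _ {F : Subset} {v : Carrierᴹ} {c : Carrier} (valid : ∀ {x} → x ∈ P → ⟨ v , x ⟩ ≤ c)
           (F≐ : F ≐ (P ∩ λ x → ⟨ v , x ⟩ ≈ c)) where

    -- The gaps a j (c - ⟨ v , g j ⟩) are nonnegative with sum c - ⟨ v , x ⟩ = 0. Each therefore
    -- vanishes, which leaves no weight on generators off the hyperplane.
    face⊆ : ∀ {x} → x ∈ F → Comb convex (λ j → J j × OnHyperplane v c j) 1# x
    face⊆ {x} x∈F = comb a off (admissible cx) (total cx) (point cx)
      where
      cx = P⊆ (proj₁ (proj₁ F≐ x∈F))
      a = weights cx
      gap : Fin n → Carrier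
      gap j = a j * (c - ⟨ v , g j ⟩)
      gap≥0 : ∀ j → Dec (J j) → 0# ≤ gap j
      gap≥0 j (yes j∈J) = *-nonNegative (admissible cx j) (x≤y⇒0≤y-x (valid (P⊇ (Comb-generator j∈J))))
      gap≥0 j (no  j∉J) = ≤-reflexive (sym (trans (*-congʳ (supported cx j j∉J)) (zeroˡ _)))
      total-gap : sum gap ≈ 0#
      total-gap = begin
        sum gap
          ≈⟨ sum-cong {n} (λ j → solve 3 (λ a c x → a :* (c :- x) := c :* a :- a :* x) refl (a j) c _) ⟩
        sum (λ j → c * a j - a j * ⟨ v , g j ⟩)            ≈⟨ sum-- (λ j → c * a j) (λ j → a j * ⟨ v , g j ⟩) ⟩
        sum (λ j → c * a j) - sum (λ j → a j * ⟨ v , g j ⟩)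
          ≈⟨ +-cong (sym (*-distribˡ-sum c a)) (-‿cong (sym (weighted-pairing v cx))) ⟩
        c * sum a - ⟨ v , x ⟩
          ≈⟨ +-cong (trans (*-congˡ (total cx)) (*-identityʳ c)) (-‿cong (proj₂ (proj₁ F≐ x∈F))) ⟩
        c - c                                              ≈⟨ -‿inverseʳ c ⟩
        0#                                                 ∎
      off′ : ∀ j → Dec (J j) → ¬ (J j × OnHyperplane v c j) → a j ≈ 0#
      off′ j (no  j∉J) _ = supported cx j j∉J
      off′ j (yes j∈J) j-off = *-cancel-nonZero
        (λ gap≈0 → j-off (j∈J , (begin
          ⟨ v , g j ⟩                        ≈⟨ solve 2 (λ x c → x := c :- (c :- x)) refl _ c ⟩
          c - (c - ⟨ v , g j ⟩)              ≈⟨ +-congˡ (-‿cong gap≈0) ⟩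
          c - 0#                             ≈⟨ solve 1 (λ c → c :- con ℤ.0ℤ := c) refl c ⟩
          c                                  ∎)))
        (trans (*-comm _ _) (sum≈0⇒term≈0 (λ l → gap≥0 l (J? l)) total-gap j))
      off : ∀ j → ¬ (J j × OnHyperplane v c j) → a j ≈ 0#
      off j = off′ j (J? j)

    face⊇ : ∀ {x} → Comb convex (λ j → J j × OnHyperplane v c j) 1# x → x ∈ F
    face⊇ cx = proj₂ F≐ (P⊇ (Comb-mono proj₁ cx) ,
      trans (hyperplane-pairing proj₂ (on? v c) cx) (*-identityˡ c))

  module _ {j₀} (j₀∈J : J j₀)
    (symmetric : ∀ {j} → J j → ∃ λ j′ → J j′ × g j′ ≈ᴹ (- 1#) *ₗ g j) where

    origin : 0ᴹ ∈ P
    origin = P⊇ (Comb-resp (trans (+-cong (*-identityʳ ½) (*-identityʳ ½)) ½+½≈1)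
      (≈ᴹ-trans (+ᴹ-congˡ (*ₗ-congˡ (proj₂ (proj₂ (symmetric j₀∈J)))))
        (linear (½ ⊙ ↑ g j₀ ⊕ ½ ⊙ (- 1#) ⊙ ↑ g j₀) 𝟎 λ z →
          solve 2 (λ h x → h :* x :+ h :* ((:- con ℤ.1ℤ) :* x) := con ℤ.0ℤ) refl ½ _))
      (Comb-+ (Comb-* (proj₁ 0<½) (Comb-generator {κ = convex} j₀∈J))
              (Comb-* (proj₁ 0<½) (Comb-generator {κ = convex} (proj₁ (proj₂ (symmetric j₀∈J)))))))

    negation : ∀ {x} → x ∈ P → (- 1#) *ₗ x ∈ P
    negation x∈P = P⊇ (negate (P⊆ x∈P))
      where
      Neg : Carrier → Carrierᴹ → Set
      Neg t y = Comb convex J t ((- 1#) *ₗ y)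
      negate : ∀ {t x} → Comb convex J t x → Neg t x
      negate (comb a off 0≤a sum≈ x≈) = Comb-resp sum≈ (*ₗ-congˡ (≈ᴹ-sym x≈))
        (combination-closed Neg (Comb-resp refl (≈ᴹ-sym (*ₗ-zeroʳ _)) Comb-0)
          (λ cx cy → Comb-resp refl (≈ᴹ-sym (*ₗ-distribˡ _ _ _)) (Comb-+ cx cy)) a g λ j → term j (J? j))
        where
        term : ∀ j → Dec (J j) → Neg (a j) (a j *ₗ g j)
        term j (yes j∈J) = Comb-resp (*-identityʳ (a j))
          (≈ᴹ-trans (*ₗ-congˡ (proj₂ (proj₂ (symmetric j∈J))))
            (linear (a j ⊙ (- 1#) ⊙ ↑ g j) ((- 1#) ⊙ a j ⊙ ↑ g j) λ z →
              solve 2 (λ a x → a :* ((:- con ℤ.1ℤ) :* x) := (:- con ℤ.1ℤ) :* (a :* x)) refl _ _))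
          (Comb-* (0≤a j) (Comb-generator {κ = convex} (proj₁ (proj₂ (symmetric j∈J)))))
        term j (no  j∉J) = Comb-resp (sym (off j j∉J))
          (≈ᴹ-sym (≈ᴹ-trans (*ₗ-congˡ (≈ᴹ-trans (*ₗ-congʳ (off j j∉J)) (*ₗ-zeroˡ _))) (*ₗ-zeroʳ _))) Comb-0

    -- The origin gives c ≥ 0. If c were zero, validity at x and at -x would put all of `P` on the
    -- hyperplane.
    proper-face-level : ∀ {F : Subset} {v c} → (∀ {x} → x ∈ P → ⟨ v , x ⟩ ≤ c) →
      F ≐ (P ∩ λ x → ⟨ v , x ⟩ ≈ c) → ¬ (F ≐ P) → 0# < c
    proper-face-level {F} {v} {c} valid F≐ F≢P = 0≤c , 0≉c
      where
      0≤c : 0# ≤ c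
      0≤c = ≤-respˡ-≈ (trans (⟨⟩-symmetric v 0ᴹ) (⟨⟩-zeroˡ v)) (valid origin)
      0≉c : ¬ (0# ≈ c)
      0≉c 0≈c = F≢P ((λ x∈F → proj₁ (proj₁ F≐ x∈F)) , λ {x} x∈P → proj₂ F≐ (x∈P ,
        antisym (valid x∈P) (≤-by-difference (0≤c+ x∈P) (trans (+-congʳ (sym 0≈c))
          (trans (solve 1 (λ x → con ℤ.0ℤ :+ x := x :- con ℤ.0ℤ) refl _) (+-congˡ (-‿cong 0≈c)))))))
        where
        0≤c+ : ∀ {x} → x ∈ P → 0# ≤ c + ⟨ v , x ⟩
        0≤c+ {x} x∈P = 0≤-resp (trans (+-congˡ (-‿cong (⟨⟩-homogeneousʳ _ v x)))
          (solve 2 (λ c x → c :- (:- con ℤ.1ℤ) :* x := c :+ x) refl c _)) (x≤y⇒0≤y-x (valid (negation x∈P)))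

-- Union of independent families from orthogonal subspaces.

module OrthogonalUnion {ℝ : Reals} (E : EuclideanSpace ℝ) (definite : InnerProduct.IsDefinite E) where
  open Definite E definite

  append : ∀ {m n} → (Fin m → Carrierᴹ) → (Fin n → Carrierᴹ) → Fin (m ℕ.+ n) → Carrierᴹ
  append {zero}  p q l       = q l
  append {suc m} p q zero    = p zero
  append {suc m} p q (suc l) = append (p ∘ suc) q l

  append-↑ˡ : ∀ {m n} p (q : Fin n → Carrierᴹ) (i : Fin m) → append p q (i ↑ˡ n) ≈ᴹ p i
  append-↑ˡ p q zero    = ≈ᴹ-refl
  append-↑ˡ p q (suc i) = append-↑ˡ (p ∘ suc) q i

  append-↑ʳ : ∀ {m n} (p : Fin m → Carrierᴹ) q (j : Fin n) → append p q (m ↑ʳ j) ≈ᴹ q j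
  append-↑ʳ {zero}  p q j = ≈ᴹ-refl
  append-↑ʳ {suc m} p q j = append-↑ʳ (p ∘ suc) q j

  ↑-elim : ∀ {m n} (P : Fin (m ℕ.+ n) → Set) → (∀ i → P (i ↑ˡ n)) → (∀ j → P (m ↑ʳ j)) → ∀ l → P l
  ↑-elim {zero}  P left right l       = right l
  ↑-elim {suc m} P left right zero    = left zero
  ↑-elim {suc m} P left right (suc l) = ↑-elim (P ∘ suc) (left ∘ suc) right l

  combination-append : ∀ {m n} (c : Fin (m ℕ.+ n) → Carrier) p q →
    combination c (append p q) ≈ᴹ combination (λ i → c (i ↑ˡ n)) p +ᴹ combination (λ j → c (m ↑ʳ j)) q
  combination-append {zero}  c p q = ≈ᴹ-sym (+ᴹ-identityˡ _)
  combination-append {suc m} c p q = ≈ᴹ-trans (+ᴹ-congˡ (combination-append (c ∘ suc) (p ∘ suc) q))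
    (≈ᴹ-sym (+ᴹ-assoc _ _ _))

  orthogonal-sum≈0 : ∀ {x y} → ⟨ x , y ⟩ ≈ 0# → x +ᴹ y ≈ᴹ 0ᴹ → x ≈ᴹ 0ᴹ
  orthogonal-sum≈0 {x} {y} x⊥y x+y≈0 = definite x (begin
    ⟨ x , x ⟩                ≈⟨ +-identityʳ _ ⟨
    ⟨ x , x ⟩ + 0#           ≈⟨ +-congˡ x⊥y ⟨
    ⟨ x , x ⟩ + ⟨ x , y ⟩    ≈⟨ ⟨⟩-additiveʳ x x y ⟨
    ⟨ x , x +ᴹ y ⟩           ≈⟨ ⟨⟩-congʳ x x+y≈0 ⟩
    ⟨ x , 0ᴹ ⟩               ≈⟨ trans (⟨⟩-symmetric x 0ᴹ) (⟨⟩-zeroˡ x) ⟩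
    0#                       ∎)

  -- A relation splits as x + y = 0 with x orthogonal to y, so both parts vanish separately.
  append-independent : ∀ {m n} {p : Fin m → Carrierᴹ} {q : Fin n → Carrierᴹ} →
    (∀ i j → ⟨ p i , q j ⟩ ≈ 0#) → LinearlyIndependent p → LinearlyIndependent q →
    LinearlyIndependent (append p q)
  append-independent {m} {n} {p} {q} p⊥q p-indep q-indep c c·pq≈0 = ↑-elim (λ l → c l ≈ 0#)
    (p-indep _ x≈0)
    (q-indep _ (orthogonal-sum≈0 (trans (⟨⟩-symmetric y x) x⊥y) (≈ᴹ-trans (+ᴹ-comm y x) x+y≈0)))
    where
    x = combination (λ i → c (i ↑ˡ n)) p
    y = combination (λ j → c (m ↑ʳ j)) q
    x+y≈0 : x +ᴹ y ≈ᴹ 0ᴹ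
    x+y≈0 = ≈ᴹ-trans (≈ᴹ-sym (combination-append c p q)) c·pq≈0
    x⊥y : ⟨ x , y ⟩ ≈ 0#
    x⊥y = orthogonal-combination _ q λ j → trans (⟨⟩-symmetric x (q j))
      (orthogonal-combination _ p λ i → trans (⟨⟩-symmetric (q j) (p i)) (p⊥q i j))
    x≈0 : x ≈ᴹ 0ᴹ
    x≈0 = orthogonal-sum≈0 x⊥y x+y≈0

  -- Each dimension is one less than a number of vectors. Adding `k` undoes these shifts, and the
  -- remaining -1 is the shift of the union.
  orthogonal-union : ∀ {k} (n : Fin k → ℕ) (p : ∀ i → Fin (n i) → Carrierᴹ) →
    (∀ {i j} → i ≢ j → ∀ l l′ → ⟨ p i l , p j l′ ⟩ ≈ 0#) → (∀ i → LinearlyIndependent (p i)) →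
    (d : Fin k → ℤ.ℤ) → (∀ i → d i ≡ ℤ.+ n i ℤ.- ℤ.1ℤ) →
    ∃ λ m → Σ (Fin m → Carrierᴹ) λ q → LinearlyIndependent q ×
      (∀ l → ∃ λ i → ∃ λ l′ → q l ≈ᴹ p i l′) × (∀ i l′ → ∃ λ l → q l ≈ᴹ p i l′) ×
      ℤ.+ k ℤ.- ℤ.1ℤ ℤ.+ sumℤ d ≡ ℤ.+ m ℤ.- ℤ.1ℤ
  orthogonal-union {zero}  n p orth indep d d≡ = zero , (λ ()) , (λ _ _ ()) , (λ ()) , (λ ()) , ≡.refl
  orthogonal-union {suc k} n p orth indep d d≡
    with orthogonal-union (n ∘ suc) (λ i → p (suc i)) (λ i≢j → orth (i≢j ∘ Fin.suc-injective))
           (indep ∘ suc) (d ∘ suc) (d≡ ∘ suc)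
  ... | m , q , q-indep , q∈ , p∈ , count =
    n zero ℕ.+ m , append (p zero) q ,
    append-independent
      (λ l l′ → let i , l″ , eq = q∈ l′ in trans (⟨⟩-congʳ _ eq) (orth (λ ()) l l″))
      (indep zero) q-indep ,
    ↑-elim (λ l → ∃ λ i → ∃ λ l′ → append (p zero) q l ≈ᴹ p i l′)
      (λ l → zero , l , append-↑ˡ (p zero) q l)
      (λ l → let i , l′ , eq = q∈ l in suc i , l′ , ≈ᴹ-trans (append-↑ʳ (p zero) q l) eq) ,
    (λ { zero l → l ↑ˡ m , append-↑ˡ (p zero) q l
       ; (suc i) l′ → let l , eq = p∈ i l′ in n zero ↑ʳ l , ≈ᴹ-trans (append-↑ʳ (p zero) q l) eq }) ,
    count⁺
    where
    count⁺ : ℤ.+ suc k ℤ.- ℤ.1ℤ ℤ.+ sumℤ d ≡ ℤ.+ (n zero ℕ.+ m) ℤ.- ℤ.1ℤ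
    count⁺ = ≡.trans (≡.cong (λ e → ℤ.+ suc k ℤ.- ℤ.1ℤ ℤ.+ (e ℤ.+ sumℤ (d ∘ suc))) (d≡ zero))
      (≡.trans (rearrange (ℤ.+ k) (ℤ.+ n zero) (sumℤ (d ∘ suc)))
      (≡.trans (≡.cong (ℤ._+_ (ℤ.+ n zero)) count)
        (≡.sym (ℤ.+-assoc (ℤ.+ n zero) (ℤ.+ m) (ℤ.- ℤ.1ℤ)))))
      where
      open ℤ.+-*-Solver renaming (solve to solveℤ; _:+_ to _⊞_; _:-_ to _⊟_; _:=_ to _≐ℤ_; con to conℤ)
      rearrange : ∀ k a s → (ℤ.1ℤ ℤ.+ k) ℤ.- ℤ.1ℤ ℤ.+ ((a ℤ.- ℤ.1ℤ) ℤ.+ s) ≡ a ℤ.+ (k ℤ.- ℤ.1ℤ ℤ.+ s)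
      rearrange = solveℤ 3 (λ k a s → (conℤ ℤ.1ℤ ⊞ k) ⊟ conℤ ℤ.1ℤ ⊞ ((a ⊟ conℤ ℤ.1ℤ) ⊞ s)
        ≐ℤ a ⊞ (k ⊟ conℤ ℤ.1ℤ ⊞ s)) ≡.refl

-- Roots and root polytopes of the components.

module Decomposition {ℝ : Reals} (E : EuclideanSpace ℝ) (definite : InnerProduct.IsDefinite E)
  (Φ : Geometry.RootSystem E) (Π : Geometry.SimpleRoots E Φ) {k : ℕ} (i₀ : Fin k)
  (Φᵢ : Fin k → Geometry.Subset E) (components : Geometry.IrreducibleComponents E Φ Φᵢ) where
  open RelativeInterior E definite
  open OrthogonalUnion E definite using (orthogonal-union)
  open RootSystem Φ renaming (size to N; root to g)
  open SimpleRoots Π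
  open Family g

  𝒫 : Subset
  𝒫 = convexHull roots

  𝔼ᵢ 𝒫ᵢ 𝒞ᵢ : Fin k → Subset
  𝔼ᵢ i = span (Φᵢ i)
  𝒫ᵢ i = convexHull (Φᵢ i)
  𝒞ᵢ i = chamber ∩ 𝔼ᵢ i

  -- A component chosen by the covering proof. Comparing these choices in `Fin k` is decidable,
  -- whereas membership in `Φᵢ i` need not be.
  component : Fin N → Fin k
  component j = proj₁ (proj₁ (proj₁ components) (j , ≈ᴹ-refl))

  root∈component : ∀ j → g j ∈ Φᵢ (component j)
  root∈component j = proj₂ (proj₁ (proj₁ components) (j , ≈ᴹ-refl))

  root-norm≉0 : ∀ j → ¬ (⟨ g j , g j ⟩ ≈ 0#)
  root-norm≉0 j = nonzero (j , ≈ᴹ-refl) ∘ definite (g j)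

  orthogonal-component : ∀ {i j y} → component j ≢ i → y ∈ Φᵢ i → ⟨ g j , y ⟩ ≈ 0#
  orthogonal-component {j = j} j∉i = proj₁ (proj₂ components) j∉i (root∈component j)

  -- If the chosen component of a root in `Φᵢ i` were another one, the root would be orthogonal to
  -- itself.
  component-root : ∀ {i y} → y ∈ Φᵢ i → ∃ λ j → component j ≡ i × g j ≈ᴹ y
  component-root {i} {y} y∈Φᵢ = j , same (component j Fin.≟ i) , j≈y
    where
    y∈Φ = proj₂ (proj₁ components) (i , y∈Φᵢ)
    j = proj₁ y∈Φ
    j≈y = proj₂ y∈Φ
    same : Dec (component j ≡ i) → component j ≡ i
    same (yes eq) = eq
    same (no neq) = ⊥-elim (root-norm≉0 j (trans (⟨⟩-congʳ _ j≈y) (orthogonal-component neq y∈Φᵢ)))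

  In : Fin k → Pred (Fin N) 0ℓ
  In i j = component j ≡ i

  In? : ∀ i j → Dec (In i j)
  In? i j = component j Fin.≟ i

  root∈ : ∀ {i j} → In i j → g j ∈ Φᵢ i
  root∈ {j = j} ≡.refl = root∈component j

  someRoot : ∀ i → ∃ (In i)
  someRoot i = let y , y∈Φᵢ = proj₁ (proj₂ (proj₂ components) i); j , j∈i , _ = component-root y∈Φᵢ in j , j∈i

  reflect-self : ∀ j → reflect (g j) (g j) ≈ᴹ (- 1#) *ₗ g j
  reflect-self j = linear (↑ g j ⊝ s ⊙ ↑ g j) ((- 1#) ⊙ ↑ g j) λ z →
    trans (+-congˡ (-‿cong (*-congʳ s≈2)))
      (solve 1 (λ x → x :- (con ℤ.1ℤ :+ con ℤ.1ℤ) :* x := (:- con ℤ.1ℤ) :* x) refl _)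
    where
    s = fromℕ 2 * ⟨ g j , g j ⟩ * ⟨ g j , g j ⟩ ⁻¹
    s≈2 : s ≈ 2#
    s≈2 = trans (*-assoc _ _ _) (trans (*-congˡ (⁻¹-inverseʳ (root-norm≉0 j)))
      (trans (*-identityʳ _) (+-congˡ (+-identityʳ 1#))))

  -- The opposite root is the reflection of the root in itself; not being orthogonal to it, it stays
  -- in the same component.
  oppositeRoot : ∀ {i j} → In i j → ∃ λ j′ → In i j′ × g j′ ≈ᴹ (- 1#) *ₗ g j
  oppositeRoot {j = j} ≡.refl = j′ , same (In? (component j) j′) , j′≈
    where
    closed = reflectionClosed {g j} {g j} (j , ≈ᴹ-refl) (j , ≈ᴹ-refl)
    j′ = proj₁ closed
    j′≈ : g j′ ≈ᴹ (- 1#) *ₗ g j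
    j′≈ = ≈ᴹ-trans (proj₂ closed) (reflect-self j)
    same : Dec (In (component j) j′) → In (component j) j′
    same (yes eq) = eq
    same (no neq) = ⊥-elim (root-norm≉0 j (begin
      ⟨ g j , g j ⟩                ≈⟨ solve 1 (λ x → x := :- ((:- con ℤ.1ℤ) :* x)) refl _ ⟩
      - (- 1# * ⟨ g j , g j ⟩)     ≈⟨ -‿cong (trans (⟨⟩-congˡ _ j′≈) (⟨⟩-homogeneousˡ _ _ _)) ⟨
      - ⟨ g j′ , g j ⟩             ≈⟨ -‿cong (orthogonal-component neq (root∈component j)) ⟩
      - 0#                         ≈⟨ -0#≈0# ⟩
      0#                           ∎))

  -- The orthogonal complement of the other components, which is 𝔼ᵢ i.
  Inside : Fin k → Subset
  Inside i y = ∀ j → component j ≢ i → ⟨ g j , y ⟩ ≈ 0#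

  span⊆Inside : ∀ {i y} → y ∈ 𝔼ᵢ i → Inside i y
  span⊆Inside (_ , c , p , p∈Φᵢ , y≈) j j∉i = trans (⟨⟩-congʳ _ y≈)
    (orthogonal-combination c p λ l → orthogonal-component j∉i (p∈Φᵢ l))

  root-Inside : ∀ {i l} → In i l → Inside i (g l)
  root-Inside l∈i j j∉i = orthogonal-component j∉i (root∈ l∈i)

  Inside-resp : ∀ {i x y} → x ≈ᴹ y → Inside i x → Inside i y
  Inside-resp x≈y in-x j j∉i = trans (⟨⟩-congʳ _ (≈ᴹ-sym x≈y)) (in-x j j∉i)

  Comb-Inside : ∀ {i κ J t x} → (∀ {j} → J j → In i j) → Comb κ J t x → Inside i x
  Comb-Inside {i} J⊆i (comb a off _ _ x≈) l l∉i = trans (⟨⟩-congʳ _ x≈) (trans (⟨⟩-combinationʳ a g (g l))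
    (sum-zero {N} λ j → term j (In? i j)))
    where
    term : ∀ j → Dec (In i j) → a j * ⟨ g l , g j ⟩ ≈ 0#
    term j (yes j∈i) = trans (*-congˡ (root-Inside j∈i l l∉i)) (zeroʳ _)
    term j (no  j∉i) = trans (*-congʳ (off j (j∉i ∘ J⊆i))) (zeroˡ _)

  -- Roots of the other components pair to zero with `y`, whatever their weights. This lets weights
  -- be cut to one component and be prescribed on each component separately.
  pairing-local : ∀ {i y} {a b : Fin N → Carrier} → Inside i y → (∀ j → In i j → a j ≈ b j) →
    ⟨ combination a g , y ⟩ ≈ ⟨ combination b g , y ⟩
  pairing-local {i} {y} {a} {b} in-y same = trans (⟨⟩-combinationˡ a g y)
    (trans (sum-cong {N} λ j → term j (In? i j)) (sym (⟨⟩-combinationˡ b g y)))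
    where
    term : ∀ j → Dec (In i j) → a j * ⟨ g j , y ⟩ ≈ b j * ⟨ g j , y ⟩
    term j (yes j∈i) = *-congʳ (same j j∈i)
    term j (no  j∉i) = trans (trans (*-congˡ (in-y j j∉i)) (zeroʳ _)) (sym (trans (*-congˡ (in-y j j∉i)) (zeroʳ _)))

  at-component : ∀ {i j} (b : Fin k → Fin N → Carrier) → In i j → b (component j) j ≈ b i j
  at-component b ≡.refl = refl

  restrictTo : Fin k → (Fin N → Carrier) → Fin N → Carrier
  restrictTo i a j = restrict (In? i j) (a j)

  -- The difference `r` lies inside component `i`, where the full and the restricted weights pair
  -- equally, so `r` is orthogonal to itself.
  Inside-point : ∀ {i x a} → Inside i x → x ≈ᴹ combination a g → x ≈ᴹ combination (restrictTo i a) g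
  Inside-point {i} {x} {a} in-x x≈ = x-y≈0⇒x≈y (definite r (begin
    ⟨ x -ᴹ xᵢ , r ⟩           ≈⟨ ⟨⟩-minusˡ x xᵢ r ⟩
    ⟨ x , r ⟩ - ⟨ xᵢ , r ⟩
      ≈⟨ +-cong (⟨⟩-congˡ r x≈) (-‿cong (pairing-local in-r λ j j∈i → restrict-yes (In? i j) j∈i)) ⟩
    ⟨ combination a g , r ⟩ - ⟨ combination a g , r ⟩   ≈⟨ -‿inverseʳ _ ⟩
    0#                        ∎))
    where
    xᵢ = combination (restrictTo i a) g
    r = x -ᴹ xᵢ
    in-xᵢ : Inside i xᵢ
    in-xᵢ = Comb-Inside id (comb {κ = affine} (restrictTo i a) (λ j → restrict-no (In? i j)) (λ _ → tt) refl ≈ᴹ-refl)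
    in-r : Inside i r
    in-r j j∉i = trans (⟨⟩-minusʳ _ x xᵢ) (trans (+-cong (in-x j j∉i) (-‿cong (in-xᵢ j j∉i))) (-‿inverseʳ 0#))

  All : Pred (Fin N) 0ℓ
  All _ = ⊤

  𝒫⊆ : ∀ {x} → x ∈ 𝒫 → Comb convex All 1# x
  𝒫⊆ = hull⊆Comb {S = roots} λ (j , j≈) → Comb-resp refl j≈ (Comb-generator tt)

  𝒫⊇ : ∀ {x} → Comb convex All 1# x → x ∈ 𝒫
  𝒫⊇ = Comb⊆hull (λ _ → yes tt) {roots} λ {j} _ → j , ≈ᴹ-refl

  𝒫ᵢ⊆ : ∀ {i x} → x ∈ 𝒫ᵢ i → Comb convex (In i) 1# x
  𝒫ᵢ⊆ = hull⊆Comb λ y∈Φᵢ → let j , j∈i , j≈ = component-root y∈Φᵢ in Comb-resp refl j≈ (Comb-generator j∈i)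

  𝒫ᵢ⊇ : ∀ {i x} → Comb convex (In i) 1# x → x ∈ 𝒫ᵢ i
  𝒫ᵢ⊇ {i} = Comb⊆hull (In? i) {Φᵢ i} root∈

  module Whole = SymmetricPolytope E definite g {All} (λ _ → yes tt) 𝒫⊆ 𝒫⊇
  module Part (i : Fin k) = SymmetricPolytope E definite g {In i} (In? i) 𝒫ᵢ⊆ 𝒫ᵢ⊇

  allSymmetric : ∀ {j} → ⊤ → ∃ λ j′ → ⊤ × g j′ ≈ᴹ (- 1#) *ₗ g j
  allSymmetric {j} _ = let j′ , _ , eq = oppositeRoot {component j} {j} ≡.refl in j′ , tt , eq

  origin : 0ᴹ ∈ 𝒫
  origin = Whole.origin {proj₁ (someRoot i₀)} tt allSymmetric

  originᵢ : ∀ i → 0ᴹ ∈ 𝒫ᵢ i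
  originᵢ i = Part.origin i (proj₂ (someRoot i)) oppositeRoot

  𝒫ᵢ⊆𝒫 : ∀ {i x} → x ∈ 𝒫ᵢ i → x ∈ 𝒫
  𝒫ᵢ⊆𝒫 x∈𝒫ᵢ = 𝒫⊇ (Comb-mono (λ _ → tt) (𝒫ᵢ⊆ x∈𝒫ᵢ))

  𝒫ᵢ⊆𝔼ᵢ : ∀ {i x} → x ∈ 𝒫ᵢ i → x ∈ 𝔼ᵢ i
  𝒫ᵢ⊆𝔼ᵢ (n , c , p , p∈Φᵢ , _ , _ , x≈) = n , c , p , p∈Φᵢ , x≈

  -- The weights outside of the component are moved to the origin.
  𝒫∩𝔼ᵢ⊆𝒫ᵢ : ∀ {i x} → x ∈ 𝒫 → x ∈ 𝔼ᵢ i → x ∈ 𝒫ᵢ i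
  𝒫∩𝔼ᵢ⊆𝒫ᵢ {i} {x} x∈𝒫 x∈𝔼ᵢ = 𝒫ᵢ⊇ (Comb-resp
    (solve 1 (λ s → s :+ (con ℤ.1ℤ :- s) :* con ℤ.1ℤ := con ℤ.1ℤ) refl s)
    (≈ᴹ-trans (+ᴹ-congˡ (*ₗ-zeroʳ _)) (+ᴹ-identityʳ x))
    (Comb-+ restricted (Comb-* 0≤1-s (𝒫ᵢ⊆ (originᵢ i)))))
    where
    cx = 𝒫⊆ x∈𝒫
    a = weights cx
    s = sum (restrictTo i a)
    restricted : Comb convex (In i) s x
    restricted = comb (restrictTo i a) (λ j → restrict-no (In? i j))
      (λ j → restrict-nonNegative (In? i j) (admissible cx j)) refl
      (Inside-point (span⊆Inside x∈𝔼ᵢ) (point cx))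
    0≤1-s : 0# ≤ 1# - s
    0≤1-s = x≤y⇒0≤y-x (≤-respʳ-≈ (total cx) (sum-mono-≤ λ j → restrict-≤ (In? i j) (admissible cx j)))

  root∈𝔼ᵢ : ∀ {i j} → In i j → g j ∈ 𝔼ᵢ i
  root∈𝔼ᵢ j∈i = 𝒫ᵢ⊆𝔼ᵢ (𝒫ᵢ⊇ (Comb-generator j∈i))

  -- Restriction of a face to the components.

  module _ {F : Subset} {v : Carrierᴹ} {c : Carrier} (valid : ∀ {x} → x ∈ 𝒫 → ⟨ v , x ⟩ ≤ c)
           (F≐ : F ≐ (𝒫 ∩ λ x → ⟨ v , x ⟩ ≈ c)) where

    On : Pred (Fin N) 0ℓ
    On j = ⊤ × ⟨ v , g j ⟩ ≈ c

    On? : ∀ j → Dec (On j)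
    On? = Whole.on? v c

    Onᵢ : Fin k → Pred (Fin N) 0ℓ
    Onᵢ i j = In i j × ⟨ v , g j ⟩ ≈ c

    Onᵢ? : ∀ i j → Dec (Onᵢ i j)
    Onᵢ? i = Part.on? i v c

    On⇒Onᵢ : ∀ {j} → On j → Onᵢ (component j) j
    On⇒Onᵢ (_ , on) = ≡.refl , on

    F⊆ : ∀ {x} → x ∈ F → Comb convex On 1# x
    F⊆ = Whole.face⊆ valid F≐

    F⊇ : ∀ {x} → Comb convex On 1# x → x ∈ F
    F⊇ = Whole.face⊇ valid F≐

    Fᵢ : Fin k → Subset
    Fᵢ i = F ∩ 𝔼ᵢ i

    validᵢ : ∀ i {x} → x ∈ 𝒫ᵢ i → ⟨ v , x ⟩ ≤ c
    validᵢ i x∈𝒫ᵢ = valid (𝒫ᵢ⊆𝒫 x∈𝒫ᵢ)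

    -- The inequality that cuts out `F` also cuts out each restriction, because 𝒫 ∩ 𝔼ᵢ = 𝒫ᵢ.
    Fᵢ≐ : ∀ i → Fᵢ i ≐ (𝒫ᵢ i ∩ λ x → ⟨ v , x ⟩ ≈ c)
    Fᵢ≐ i = (λ (x∈F , x∈𝔼ᵢ) → let x∈𝒫 , on = proj₁ F≐ x∈F in 𝒫∩𝔼ᵢ⊆𝒫ᵢ x∈𝒫 x∈𝔼ᵢ , on) ,
            (λ (x∈𝒫ᵢ , on) → proj₂ F≐ (𝒫ᵢ⊆𝒫 x∈𝒫ᵢ , on) , 𝒫ᵢ⊆𝔼ᵢ x∈𝒫ᵢ)

    Fᵢ-face : ∀ i → IsFace (𝒫ᵢ i) (Fᵢ i)
    Fᵢ-face i = v , c , validᵢ i , Fᵢ≐ i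

    Fᵢ⊆ : ∀ i {x} → x ∈ Fᵢ i → Comb convex (Onᵢ i) 1# x
    Fᵢ⊆ i = Part.face⊆ i (validᵢ i) (Fᵢ≐ i)

    Fᵢ⊇ : ∀ i {x} → Comb convex (Onᵢ i) 1# x → x ∈ Fᵢ i
    Fᵢ⊇ i = Part.face⊇ i (validᵢ i) (Fᵢ≐ i)

    -- Dimension of proper faces.

    module _ (F≢𝒫 : ¬ (F ≐ 𝒫)) where

      0<c : 0# < c
      0<c = Whole.proper-face-level {proj₁ (someRoot i₀)} tt allSymmetric valid F≐ F≢𝒫

      c≉0 : ¬ (c ≈ 0#)
      c≉0 = positive⇒nonZero 0<c

      -- Each 𝒫ᵢ contains the origin, where the functional takes the value 0 instead of c.
      Fᵢ-proper : ∀ i → ¬ (Fᵢ i ≐ 𝒫ᵢ i)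
      Fᵢ-proper i (_ , 𝒫ᵢ⊆Fᵢ) = c≉0 (trans (sym (proj₂ (proj₁ (Fᵢ≐ i) (𝒫ᵢ⊆Fᵢ (originᵢ i)))))
        (trans (⟨⟩-symmetric v 0ᴹ) (⟨⟩-zeroˡ v)))

      level-of-affine : ∀ {i t x} → Comb affine (Onᵢ i) t x → ⟨ v , x ⟩ ≈ t * c
      level-of-affine {i} = Whole.hyperplane-pairing proj₂ (Onᵢ? i)

      -- The hyperplane misses the origin, so affine combinations of points on it
      -- are the linear ones that stay on it.
      pairing-on-hyperplane : ∀ {n} {p : Fin n → Carrierᴹ} (a : Fin n → Carrier) →
        (∀ l → ⟨ v , p l ⟩ ≈ c) → ⟨ v , combination a p ⟩ ≈ sum a * c
      pairing-on-hyperplane {p = p} a on = trans (⟨⟩-combinationʳ a p v)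
        (trans (sum-cong λ l → *-congˡ (on l)) (sym (*-distribʳ-sum c a)))

      dimensionᵢ : ∀ i → ∃ λ d → HasDimension (Fᵢ i) d
      dimensionᵢ i = basis (independent-subfamily g (Onᵢ? i))
        where
        basis : (∃ λ m → Σ (Fin m → Carrierᴹ) λ p → LinearlyIndependent p ×
          (∀ l → ∃ λ j → Onᵢ i j × p l ≈ᴹ g j) ×
          (∀ {j} → Onᵢ i j → Σ (Fin m → Carrier) λ a → g j ≈ᴹ combination a p)) →
          ∃ λ d → HasDimension (Fᵢ i) d
        basis (m , p , p-independent , p∈ , g∈) = _ , m , p , (λ a _ → p-independent a) ,
          (p⊆ , p⊇) , ≡.refl
          where
          on-p : ∀ l → ⟨ v , p l ⟩ ≈ c
          on-p l = let j , (_ , on) , eq = p∈ l in trans (⟨⟩-congʳ v eq) on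
          p⊆ : ∀ {x} → x ∈ affineHull (Range p) → x ∈ affineHull (Fᵢ i)
          p⊆ x∈ = affineHull⊇ g (Onᵢ? i) (Fᵢ⊆ i) (Fᵢ⊇ i) (hull⊆Comb {S = Range p}
            (λ (l , eq) → let j , on , eq′ = p∈ l in Comb-resp refl (≈ᴹ-trans (≈ᴹ-sym eq′) eq) (Comb-generator on)) x∈)
          module p = Family p
          g-affine : ∀ {j} → Onᵢ i j → p.Comb affine (λ _ → ⊤) 1# (g j)
          g-affine {j} on = let a , eq = g∈ on in p.comb a (λ _ ∉ → ⊥-elim (∉ tt)) (λ _ → tt)
            -- Pairing with `v` forces a linear combination that lands on the hyperplane to have
            -- total one.
            (*-cancelˡ-nonZero c≉0 (begin
              c * sum a                    ≈⟨ *-comm c _ ⟩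
              sum a * c                    ≈⟨ pairing-on-hyperplane a on-p ⟨
              ⟨ v , combination a p ⟩      ≈⟨ ⟨⟩-congʳ v eq ⟨
              ⟨ v , g j ⟩                  ≈⟨ proj₂ on ⟩
              c                            ≈⟨ *-identityʳ c ⟨
              c * 1#                       ∎))
            eq
          Gens : Subset
          Gens y = ∃ λ j → Onᵢ i j × g j ≈ᴹ y
          p⊇ : ∀ {x} → x ∈ affineHull (Fᵢ i) → x ∈ affineHull (Range p)
          p⊇ x∈ = p.Comb⊆hull (λ _ → yes tt) {Range p} (λ {l} _ → l , ≈ᴹ-refl)
            (p.hull⊆Comb {S = Gens} (λ (_ , on , eq) → p.Comb-resp refl eq (g-affine on))
              (Comb⊆hull (Onᵢ? i) {Gens} (λ {j} on → j , on , ≈ᴹ-refl)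
                (affineHull⊆ g (Onᵢ? i) (Fᵢ⊆ i) (Fᵢ⊇ i) x∈)))

      -- The affine bases in `dims` are arbitrary. Their points lie on the hyperplane, so a linear
      -- relation among them has total zero and affine independence makes it trivial; their
      -- orthogonal union is then a basis for `F`.
      dimension : (d : Fin k → ℤ.ℤ) → (∀ i → HasDimension (Fᵢ i) (d i)) →
                  HasDimension F (ℤ.+ k ℤ.- ℤ.1ℤ ℤ.+ sumℤ d)
      dimension d dims =
        join (orthogonal-union n p orthogonal p-independent d λ i → proj₂ (proj₂ (proj₂ (proj₂ (dims i)))))
        where
        n : Fin k → ℕ
        n i = proj₁ (dims i)
        p : ∀ i → Fin (n i) → Carrierᴹ
        p i = proj₁ (proj₂ (dims i))
        affine-independent : ∀ i → AffinelyIndependent (p i)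
        affine-independent i = proj₁ (proj₂ (proj₂ (dims i)))
        hulls : ∀ i → affineHull (Range (p i)) ≐ affineHull (Fᵢ i)
        hulls i = proj₁ (proj₂ (proj₂ (proj₂ (dims i))))
        p-affine : ∀ i l → Comb affine (Onᵢ i) 1# (p i l)
        p-affine i l = affineHull⊆ g (Onᵢ? i) (Fᵢ⊆ i) (Fᵢ⊇ i)
          (proj₁ (hulls i) (hull-extensive affine {Range (p i)} (l , ≈ᴹ-refl)))
        on-p : ∀ i l → ⟨ v , p i l ⟩ ≈ c
        on-p i l = trans (level-of-affine (p-affine i l)) (*-identityˡ c)
        orthogonal : ∀ {i j} → i ≢ j → ∀ l l′ → ⟨ p i l , p j l′ ⟩ ≈ 0#
        orthogonal {i} {j} i≢j l l′ = trans (⟨⟩-congˡ _ (point cx)) (trans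
          (pairing-local {b = λ _ → 0#} (Comb-Inside {j} proj₁ (p-affine j l′))
            λ m m∈j → supported cx m λ (m∈i , _) → i≢j (≡.trans (≡.sym m∈i) m∈j))
          (trans (⟨⟩-congˡ _ (combination-zero g λ _ → refl)) (⟨⟩-zeroˡ _)))
          where cx = p-affine i l
        p-independent : ∀ i → LinearlyIndependent (p i)
        p-independent i a a·p≈0 = affine-independent i a
          (*-cancel-nonZero c≉0 (trans (*-comm c _) (trans (sym (pairing-on-hyperplane a (on-p i)))
            (trans (⟨⟩-congʳ v a·p≈0) (trans (⟨⟩-symmetric v 0ᴹ) (⟨⟩-zeroˡ v)))))) a·p≈0
        join : (∃ λ m → Σ (Fin m → Carrierᴹ) λ q → LinearlyIndependent q ×
          (∀ l → ∃ λ i → ∃ λ l′ → q l ≈ᴹ p i l′) × (∀ i l′ → ∃ λ l → q l ≈ᴹ p i l′) ×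
          ℤ.+ k ℤ.- ℤ.1ℤ ℤ.+ sumℤ d ≡ ℤ.+ m ℤ.- ℤ.1ℤ) → HasDimension F (ℤ.+ k ℤ.- ℤ.1ℤ ℤ.+ sumℤ d)
        join (m , q , q-independent , q∈ , p∈ , count) = m , q , (λ a _ → q-independent a) , (q⊆ , q⊇) , count
          where
          module q = Family q
          q⊆ : ∀ {x} → x ∈ affineHull (Range q) → x ∈ affineHull F
          q⊆ x∈ = affineHull⊇ g On? F⊆ F⊇ (hull⊆Comb {S = Range q}
            (λ (l , eq) → let i , l′ , eq′ = q∈ l in
              Comb-resp refl (≈ᴹ-trans (≈ᴹ-sym eq′) eq) (Comb-mono (λ (_ , on) → tt , on) (p-affine i l′))) x∈)
          Gens : Subset
          Gens y = ∃ λ j → On j × g j ≈ᴹ y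
          p-in-q : ∀ i {y} → y ∈ affineHull (Range (p i)) → q.Comb affine (λ _ → ⊤) 1# y
          p-in-q i = q.hull⊆Comb {S = Range (p i)} λ (l′ , eq) → let l , eq′ = p∈ i l′ in
            q.Comb-resp refl (≈ᴹ-trans eq′ eq) (q.Comb-generator tt)
          g-in-q : ∀ {j} → On j → q.Comb affine (λ _ → ⊤) 1# (g j)
          g-in-q {j} on = p-in-q (component j) (proj₂ (hulls (component j))
            (hull-extensive affine {Fᵢ (component j)} (Fᵢ⊇ _ (Comb-generator (On⇒Onᵢ on)))))
          q⊇ : ∀ {x} → x ∈ affineHull F → x ∈ affineHull (Range q)
          q⊇ x∈ = q.Comb⊆hull (λ _ → yes tt) {Range q} (λ {l} _ → l , ≈ᴹ-refl)
            (q.hull⊆Comb {S = Gens} (λ (_ , on , eq) → q.Comb-resp refl eq (g-in-q on))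
              (Comb⊆hull On? {Gens} (λ {j} on → j , on , ≈ᴹ-refl)
                (affineHull⊆ g On? F⊆ F⊇ x∈)))

    -- Standard faces.

    index : Fin rank → Fin N
    index s = proj₁ (simple∈Φ s)

    simple≈ : ∀ s → g (index s) ≈ᴹ simple s
    simple≈ s = proj₂ (simple∈Φ s)

    simple-Inside : ∀ s → Inside (component (index s)) (simple s)
    simple-Inside s = Inside-resp (simple≈ s) (root-Inside ≡.refl)

    scale-chamber : ∀ {t x} → 0# < t → x ∈ chamber → t *ₗ x ∈ chamber
    scale-chamber {t} {x} 0<t x∈𝒞 s = 0≤-resp (sym (⟨⟩-homogeneousˡ t x (simple s))) (*-nonNegative (proj₁ 0<t) (x∈𝒞 s))

    -- Strict weights of a point of `F`, cut to component `i` and rescaled, give an interior point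
    -- of `Fᵢ i`. Rescaling needs a root of the component on the hyperplane; without one, `Fᵢ i` is
    -- empty.
    standard⇒standardᵢ : IsStandard chamber F → ∀ i → IsStandard (𝒞ᵢ i) (Fᵢ i)
    standard⇒standardᵢ (inj₂ F-empty) i = inj₂ λ x (x∈F , _) → F-empty x x∈F
    standard⇒standardᵢ (inj₁ (x , x∈int , x∈𝒞)) i =
      decide (interior⇒strict g On? F⊆ F⊇ x∈int) (Fin.any? (Onᵢ? i))
      where
      decide : StrictWeights g On 1# x → Dec (∃ (Onᵢ i)) → IsStandard (𝒞ᵢ i) (Fᵢ i)
      decide _ (no none) = inj₂ λ y y∈Fᵢ → none (support (Onᵢ? i) (Fᵢ⊆ i y∈Fᵢ))
      decide (a , off , pos , _ , x≈) (yes (j , j∈)) =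
        inj₁ (y , y∈int , scale-chamber (⁻¹-positive 0<t) xᵢ∈𝒞 , proj₂ (proj₁ y∈int))
        where
        aᵢ = restrictTo i a
        xᵢ = combination aᵢ g
        strictᵢ : StrictWeights g (Onᵢ i) (sum aᵢ) xᵢ
        strictᵢ = aᵢ , (λ l l∉ → offᵢ l l∉ (In? i l)) ,
          (λ l (l∈i , on) → 0<-resp (sym (restrict-yes (In? i l) l∈i)) (pos l (tt , on))) , refl , ≈ᴹ-refl
          where
          offᵢ : ∀ l → ¬ Onᵢ i l → (l∈? : Dec (In i l)) → restrict l∈? (a l) ≈ 0#
          offᵢ l l∉ (yes l∈i) = off l λ (_ , on) → l∉ (l∈i , on)
          offᵢ l l∉ (no  l∉i) = refl
        0<t : 0# < sum aᵢ
        0<t = total-positive {g = g} (Onᵢ? i) j∈ strictᵢ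
        y = sum aᵢ ⁻¹ *ₗ xᵢ
        y∈int : y ∈ relativeInterior (Fᵢ i)
        y∈int = strict⇒interior g (Onᵢ? i) (Fᵢ⊆ i) (Fᵢ⊇ i) (normalise {g = g} 0<t strictᵢ)
        xᵢ∈𝒞 : xᵢ ∈ chamber
        -- Simple roots of component `i` pair with `xᵢ` as they do with `x`, and all other simple
        -- roots pair to zero.
        xᵢ∈𝒞 s = local (In? i (index s))
          where
          local : Dec (In i (index s)) → 0# ≤ ⟨ xᵢ , simple s ⟩
          local (yes ≡.refl) = 0≤-resp (trans (⟨⟩-congˡ _ x≈) (pairing-local (simple-Inside s)
            λ l l∈i → sym (restrict-yes (In? i l) l∈i))) (x∈𝒞 s)
          local (no s∉i) = ≤-reflexive (sym (trans
            (pairing-local {b = λ _ → 0#} (simple-Inside s)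
              λ l l∈ → restrict-no (In? i l) λ l∈i → s∉i (≡.trans (≡.sym l∈) l∈i))
            (trans (⟨⟩-congˡ _ (combination-zero g λ _ → refl)) (⟨⟩-zeroˡ _))))

    -- The total is left free, so that an empty face is covered by the zero weights and both forms
    -- of standardness can be glued alike.
    ChamberWeights : Fin k → (Fin N → Carrier) → Set
    ChamberWeights i b = (∀ j → ¬ Onᵢ i j → b j ≈ 0#) × (∀ j → Onᵢ i j → 0# < b j) ×
      (∀ s → In i (index s) → 0# ≤ ⟨ combination b g , simple s ⟩)

    standardᵢ⇒weights : ∀ {i} → IsStandard (𝒞ᵢ i) (Fᵢ i) → ∃ (ChamberWeights i)
    standardᵢ⇒weights {i} (inj₂ empty) = (λ _ → 0#) , (λ _ _ → refl) ,
      (λ j j∈ → ⊥-elim (empty (g j) (Fᵢ⊇ i (Comb-generator j∈)))) ,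
      (λ s _ → ≤-reflexive (sym (trans (⟨⟩-congˡ _ (combination-zero g λ _ → refl)) (⟨⟩-zeroˡ _))))
    standardᵢ⇒weights {i} (inj₁ (x , x∈int , x∈𝒞 , _)) = extract (interior⇒strict g (Onᵢ? i) (Fᵢ⊆ i) (Fᵢ⊇ i) x∈int)
      where
      extract : StrictWeights g (Onᵢ i) 1# x → ∃ (ChamberWeights i)
      extract (b , off , pos , _ , x≈) = b , off , pos , λ s _ → 0≤-resp (⟨⟩-congˡ _ x≈) (x∈𝒞 s)

    -- Every root takes the weight given by its own component. A simple root sees only the weights
    -- of its component, so the chamber inequalities persist; normalising the total is possible
    -- unless `F` is empty.
    standardᵢ⇒standard : (∀ i → IsStandard (𝒞ᵢ i) (Fᵢ i)) → IsStandard chamber F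
    standardᵢ⇒standard standardᵢ = decide (Fin.any? On?)
      where
      b : ∀ i → ∃ (ChamberWeights i)
      b i = standardᵢ⇒weights (standardᵢ i)
      a : Fin N → Carrier
      a j = proj₁ (b (component j)) j
      x = combination a g
      strict : StrictWeights g On (sum a) x
      strict = a , (λ j j∉ → proj₁ (proj₂ (b (component j))) j λ (_ , on) → j∉ (tt , on)) ,
        (λ j on → proj₁ (proj₂ (proj₂ (b (component j)))) j (On⇒Onᵢ on)) , refl , ≈ᴹ-refl
      x∈𝒞 : x ∈ chamber
      x∈𝒞 s = 0≤-resp (sym (pairing-local (simple-Inside s) λ j → at-component (λ i → proj₁ (b i))))
        (proj₂ (proj₂ (proj₂ (b (component (index s))))) s ≡.refl)
      decide : Dec (∃ On) → IsStandard chamber F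
      decide (no none) = inj₂ λ y y∈F → none (support On? (F⊆ y∈F))
      decide (yes (j , on)) = inj₁ (sum a ⁻¹ *ₗ x ,
        strict⇒interior g On? F⊆ F⊇ (normalise {g = g} 0<t strict) , scale-chamber (⁻¹-positive 0<t) x∈𝒞)
        where
        0<t : 0# < sum a
        0<t = total-positive {g = g} On? on strict

  -- A face is spanned by its roots, and each root of `F` lies in one 𝔼ᵢ, hence in `G`.
  face-determined : ∀ {F G} → IsFace 𝒫 F → IsFace 𝒫 G →
    (∀ i → (F ∩ 𝔼ᵢ i) ⊆ (G ∩ 𝔼ᵢ i)) → F ⊆ G
  face-determined {F} {G} (v , c , valid , F≐) (w , e , valid′ , G≐) Fᵢ⊆Gᵢ x∈F =
    F⊇ {G} valid′ G≐ (Comb-mono transfer (F⊆ {F} valid F≐ x∈F))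
    where
    transfer : ∀ {j} → ⊤ × ⟨ v , g j ⟩ ≈ c → ⊤ × ⟨ w , g j ⟩ ≈ e
    transfer {j} on =
      tt , proj₂ (proj₁ G≐ (proj₁ (Fᵢ⊆Gᵢ (component j) (F⊇ {F} valid F≐ (Comb-generator on) , root∈𝔼ᵢ ≡.refl))))

  -- Gluing proper faces of the components.

  module _ (F̄ : Fin k → Subset) (faces : ∀ i → IsProperFace (𝒫ᵢ i) (F̄ i)) where

    v : Fin k → Carrierᴹ
    v i = proj₁ (proj₁ (faces i))

    c : Fin k → Carrier
    c i = proj₁ (proj₂ (proj₁ (faces i)))

    v-valid : ∀ i {x} → x ∈ 𝒫ᵢ i → ⟨ v i , x ⟩ ≤ c i
    v-valid i = proj₁ (proj₂ (proj₂ (proj₁ (faces i))))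

    F̄≐ : ∀ i → F̄ i ≐ (𝒫ᵢ i ∩ λ x → ⟨ v i , x ⟩ ≈ c i)
    F̄≐ i = proj₂ (proj₂ (proj₂ (proj₁ (faces i))))

    0<cᵢ : ∀ i → 0# < c i
    0<cᵢ i = Part.proper-face-level i (proj₂ (someRoot i)) oppositeRoot (v-valid i) (F̄≐ i) (proj₂ (faces i))

    -- With `v i` expanded in the roots, its projection to 𝔼ᵢ is obtained by keeping only the
    -- weights of component `i`.
    v-weights : ∀ i → ∃ λ t → Comb affine All t (v i)
    v-weights i = span⊆Comb {S = roots} (λ (j , j≈) → Comb-resp refl j≈ (Comb-generator tt)) (spanning (v i))

    -- The sum of the orthogonal projections of c i ⁻¹ *ₗ v i to 𝔼ᵢ i.
    normal : Carrierᴹ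
    normal = combination (λ j → c (component j) ⁻¹ * weights (proj₂ (v-weights (component j))) j) g

    pairing-normal : ∀ {i y} → Inside i y → ⟨ normal , y ⟩ ≈ c i ⁻¹ * ⟨ v i , y ⟩
    pairing-normal {i} {y} in-y = begin
      ⟨ normal , y ⟩
        ≈⟨ pairing-local in-y (λ j → at-component (λ i j → c i ⁻¹ * weights (proj₂ (v-weights i)) j)) ⟩
      ⟨ combination (λ j → c i ⁻¹ * weights vᵢ j) g , y ⟩  ≈⟨ ⟨⟩-congˡ y (combination-* (c i ⁻¹) (weights vᵢ) g) ⟩
      ⟨ c i ⁻¹ *ₗ combination (weights vᵢ) g , y ⟩         ≈⟨ ⟨⟩-homogeneousˡ _ _ y ⟩
      c i ⁻¹ * ⟨ combination (weights vᵢ) g , y ⟩          ≈⟨ *-congˡ (⟨⟩-congˡ y (point vᵢ)) ⟨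
      c i ⁻¹ * ⟨ v i , y ⟩                                 ∎
      where vᵢ = proj₂ (v-weights i)

    glued : Subset
    glued = 𝒫 ∩ λ x → ⟨ normal , x ⟩ ≈ 1#

    -- By convexity it suffices to test roots. On a root of component `i` the value is ⟨ v i , g j ⟩
    -- / c i, at most one since `c i` is positive.
    normal-valid : ∀ {x} → x ∈ 𝒫 → ⟨ normal , x ⟩ ≤ 1#
    normal-valid x∈𝒫 = ≤-respˡ-≈ (sym (Whole.weighted-pairing normal cx)) (≤-respʳ-≈ (total cx) (sum-mono-≤ λ j →
      ≤-respʳ-≈ (*-identityʳ _) (*-monoˡ-≤ (admissible cx j) (root-valid j))))
      where
      cx = 𝒫⊆ x∈𝒫
      root-valid : ∀ j → ⟨ normal , g j ⟩ ≤ 1#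
      root-valid j = ≤-respˡ-≈ (sym (pairing-normal (root-Inside ≡.refl)))
        (≤-respʳ-≈ (⁻¹-inverseˡ (positive⇒nonZero (0<cᵢ _)))
          (*-monoˡ-≤ (proj₁ (⁻¹-positive (0<cᵢ _))) (v-valid _ (𝒫ᵢ⊇ (Comb-generator ≡.refl)))))

    glued-proper : IsProperFace 𝒫 glued
    glued-proper = (normal , 1# , normal-valid , id , id) , λ (_ , 𝒫⊆glued) →
      0≉1 (trans (sym (trans (⟨⟩-symmetric normal 0ᴹ) (⟨⟩-zeroˡ normal))) (proj₂ (𝒫⊆glued origin)))

    glued∩𝔼ᵢ : ∀ i → (glued ∩ 𝔼ᵢ i) ≐ F̄ i
    glued∩𝔼ᵢ i = (λ ((x∈𝒫 , on) , x∈𝔼ᵢ) → proj₂ (F̄≐ i) (𝒫∩𝔼ᵢ⊆𝒫ᵢ x∈𝒫 x∈𝔼ᵢ ,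
          *-cancelˡ-nonZero (⁻¹-nonZero cᵢ≉0)
            (trans (sym (pairing-normal (span⊆Inside x∈𝔼ᵢ))) (trans on (sym (⁻¹-inverseˡ cᵢ≉0)))))) ,
        (λ x∈F̄ → let x∈𝒫ᵢ , on = proj₁ (F̄≐ i) x∈F̄; x∈𝔼ᵢ = 𝒫ᵢ⊆𝔼ᵢ x∈𝒫ᵢ in
          (𝒫ᵢ⊆𝒫 x∈𝒫ᵢ , trans (pairing-normal (span⊆Inside x∈𝔼ᵢ)) (trans (*-congˡ on) (⁻¹-inverseˡ cᵢ≉0))) , x∈𝔼ᵢ)
      where
      cᵢ≉0 : ¬ (c i ≈ 0#)
      cᵢ≉0 = positive⇒nonZero (0<cᵢ i)

open import Data.Integer.Base using (ℤ; +_; 1ℤ; _+_; _-_)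
open import Function.Bundles using (_⇔_; mk⇔)
open import Function.Structures using (IsBijection)
open import Relation.Unary.Properties using (≐-refl; ≐-sym; ≐-trans)

proposition3p10 :
  (ℝ : Reals) (E : EuclideanSpace ℝ) → let open Geometry E in
  (Φ : RootSystem) (Π : SimpleRoots Φ)
  (k : ℕ) .{{_ : NonZero k}} (Φᵢ : Fin k → Subset) → IrreducibleComponents Φ Φᵢ →
  let 𝒞  = SimpleRoots.chamber Π
      𝒫  = convexHull (RootSystem.roots Φ)
      𝔼ᵢ = λ i → span (Φᵢ i)
      𝒫ᵢ = λ i → convexHull (Φᵢ i)
      𝒞ᵢ = λ i → 𝒞 ∩ 𝔼ᵢ i
  in
  (Σ (∀ F → IsProperFace 𝒫 F → ∀ i → IsProperFace (𝒫ᵢ i) (F ∩ 𝔼ᵢ i)) λ proper →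
    IsBijection
      (_≈ᶠ_ {𝒫}) (λ (F G : ∀ i → ProperFace (𝒫ᵢ i)) → ∀ i → _≈ᶠ_ {𝒫ᵢ i} (F i) (G i))
      (λ (F , isProper) i → F ∩ 𝔼ᵢ i , proper F isProper i))
  ×
  (∀ F → IsProperFace 𝒫 F →
    (∀ i → ∃ λ d → HasDimension (F ∩ 𝔼ᵢ i) d) ×
    (∀ (d : Fin k → ℤ) → (∀ i → HasDimension (F ∩ 𝔼ᵢ i) (d i)) →
      HasDimension F (+ k - 1ℤ + sumℤ d)))
  ×
  (∀ F → IsFace 𝒫 F →
    IsStandard 𝒞 F ⇔ (∀ i → IsStandardFace (𝒞ᵢ i) (𝒫ᵢ i) (F ∩ 𝔼ᵢ i)))
proposition3p10 ℝ E Φ Π k@(suc _) Φᵢ components =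
  (proper , bijection) , dimensions , standardness
  where
  open Geometry E
  definite = SimpleRootCoordinates.definite E Φ Π
  -- The origin lies in 𝒫 only if some root exists; as `k` is positive, `zero` names a component
  -- that has one.
  open Decomposition E definite Φ Π zero Φᵢ components

  proper : ∀ F → IsProperFace 𝒫 F → ∀ i → IsProperFace (𝒫ᵢ i) (F ∩ 𝔼ᵢ i)
  proper F ((v , c , valid , F≐) , F≢𝒫) i = Fᵢ-face valid F≐ i , Fᵢ-proper valid F≐ F≢𝒫 i

  bijection : IsBijection (_≈ᶠ_ {𝒫})
    (λ (F G : ∀ i → ProperFace (𝒫ᵢ i)) → ∀ i → _≈ᶠ_ {𝒫ᵢ i} (F i) (G i))
    (λ (F , isProper) i → F ∩ 𝔼ᵢ i , proper F isProper i)
  bijection = record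
    { isInjection = record
      { isCongruent = record
        { cong           = λ (F⊆G , G⊆F) i → (λ (x∈F , x∈𝔼ᵢ) → F⊆G x∈F , x∈𝔼ᵢ) , (λ (x∈G , x∈𝔼ᵢ) → G⊆F x∈G , x∈𝔼ᵢ)
        ; isEquivalence₁ = record { refl = ≐-refl ; sym = ≐-sym ; trans = ≐-trans }
        ; isEquivalence₂ = record
          { refl = λ i → ≐-refl ; sym = λ eq i → ≐-sym (eq i) ; trans = λ eq eq′ i → ≐-trans (eq i) (eq′ i) }
        }
      ; injective = λ {(F , F-face , _)} {(G , G-face , _)} eq →
          face-determined F-face G-face (λ i → proj₁ (eq i)) , face-determined G-face F-face (λ i → proj₂ (eq i))
      }
    -- The preimage has to work up to equality of faces, so an arbitrary face equal to the glued one
    -- is restricted.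
    ; surjective = λ F̄ → let F i = proj₁ (F̄ i); isProper i = proj₂ (F̄ i) in
        (glued F isProper , glued-proper F isProper) , λ (G⊆ , ⊆G) i →
          ≐-trans ((λ (x∈G , x∈𝔼ᵢ) → G⊆ x∈G , x∈𝔼ᵢ) , (λ (x∈F , x∈𝔼ᵢ) → ⊆G x∈F , x∈𝔼ᵢ)) (glued∩𝔼ᵢ F isProper i)
    }

  dimensions : ∀ F → IsProperFace 𝒫 F →
    (∀ i → ∃ λ d → HasDimension (F ∩ 𝔼ᵢ i) d) ×
    (∀ (d : Fin k → ℤ) → (∀ i → HasDimension (F ∩ 𝔼ᵢ i) (d i)) → HasDimension F (+ k - 1ℤ + sumℤ d))
  dimensions F ((v , c , valid , F≐) , F≢𝒫) = dimensionᵢ valid F≐ F≢𝒫 , dimension valid F≐ F≢𝒫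

  standardness : ∀ F → IsFace 𝒫 F →
    IsStandard (SimpleRoots.chamber Π) F ⇔ (∀ i → IsStandardFace (𝒞ᵢ i) (𝒫ᵢ i) (F ∩ 𝔼ᵢ i))
  standardness F (v , c , valid , F≐) = mk⇔
    (λ standard i → Fᵢ-face valid F≐ i , standard⇒standardᵢ valid F≐ standard i)
    (λ standardᵢ → standardᵢ⇒standard valid F≐ (λ i → proj₂ (standardᵢ i)))
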